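{- Let $i\ge1$, $0\le k\le i$ and $\ell\ge0$ be integers. Suppose given a set of $M$ (distinct) totally singular subspaces $\bar S$ of $\bar E$, each of dimension $i-k$, such that any two distinct members of the set intersect in a space of dimension at most $\ell$. Then the set of invariant subspaces (in the sense of the context: the simultaneous eigenspaces $V_\chi$) of all the preimages $S\subseteq E$ of these subspaces $\bar S$ is a packing of $2^{i-k}M$ (distinct) planes in $G(2^i,2^k)$ whose minimal distance $d$ satisfies $$d^2\ \ge\ 2^k-2^{2k+\ell-i},$$ i.e. $d(P,P')^2\ge 2^k-2^{2k+\ell-i}$ for any two distinct planes $P,P'$ of the packing.
   Context: **Grassmannian packings.** $G(m,n)$ is the set of $n$-dimensional linear subspaces ("planes") of $\mathbb{R}^m$. The distance between $P,Q\in G(m,n)$ is $d(P,Q)=\sqrt{\sin^2\theta_1+\dots+\sin^2\theta_n}$, where $\theta_1,\dots,\theta_n$ are the principal angles between $P$ and $Q$; equivalently $d^2(P,Q)=n-\operatorname{trace}(\Pi_P\Pi_Q)$, where $\Pi_P,\Pi_Q$ are the orthogonal projection matrices onto $P,Q$. A packing of $N$ planes is a subset $\mathcal P=\{P_1,\dots,P_N\}\subset G(m,n)$ of $N$ planes; its minimal distance is $d(\mathcal P)=\min_{a\ne b}d(P_a,P_b)$. **The group $E$ and the orthogonal space $\bar E$.** Let $i\ge 1$, $U=\mathbb{F}_2^i$ with the usual dot product, and let $V=\mathbb{R}^{2^i}$ with orthonormal basis $(e_u)_{u\in U}$. For $a,b\in U$ define orthogonal transformations of $V$ by $X(a):e_u\mapsto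 e_{u+a}$ and $Y(b):e_u\mapsto(-1)^{b\cdot u}e_u$. Let $E=\{\pm X(a)Y(b):a,b\in U\}$, the group generated by all $X(a)$ and $Y(b)$; it has order $2^{2i+1}$ and center $\{\pm I\}$. Put $\bar E=E/\{\pm I\}$, an elementary abelian $2$-group of order $2^{2i}$, regarded as a $2i$-dimensional vector space over $\mathbb{F}_2$. Define the quadratic form $Q:\bar E\to\mathbb{F}_2$ by $Q(\bar g)=0$ if $g^2=I$ and $Q(\bar g)=1$ if $g^2=-I$, where $g\in E$ is any preimage of $\bar g$; thus $Q(\overline{X(a)Y(b)})=a\cdot b$. A subspace $\bar S\subseteq\bar E$ is totally singular if $Q(\bar g)=0$ for all $\bar g\in\bar S$. **Invariant subspaces.** If $\bar S\subseteq\bar E$ is a totally singular subspace of dimension $r$, its preimage $S\subseteq E$ (which contains $-I$) is an elementary abelian $2$-group of order $2^{r+1}$. The invariant subspaces of $S$ are the simultaneous eigenspaces $V_\chi=\{v\in V: gv=\chi(g)v\ \text{for all } g\in S\}$, where $\chi$ runs over the $2^r$ characters $\chi:S\to\{\pm1\}$ with $\chi(-I)=-1$. They are $2^r$ mutually orthogonal subspaces of $V$, each of dimension $2^{i-r}$. -}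

module Defs where

open import Algebra.Bundles using (CommutativeRing; Ring)
open import Algebra.Module.Bundles using (LeftModule)
import Algebra.Module.Construct.DirectProduct as DirectProduct
import Algebra.Definitions.RawMonoid as RawMonoidDefinitions
import Algebra.Properties.CommutativeMonoid.Sum as CommutativeMonoidSum
import Algebra.Properties.CommutativeSemigroup as CommutativeSemigroupProperties
import Algebra.Properties.Ring as RingProperties
import Algebra.Solver.CommutativeMonoid as CommutativeMonoidSolver
open import Data.Bool.Base using (if_then_else_)
open import Data.Fin.Base using (Fin; zero; suc; combine; quotient; remainder)
open import Data.Fin.Properties using (remQuot-combine; combine-remQuot; _≟_)
open import Data.Integer.Base using (ℤ; +_; -[1+_])
open import Data.Nat.Base as ℕ using (ℕ; zero; suc)
import Data.Parity.Base as ℙ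
open import Data.Parity.Base using (Parity; 0ℙ; 1ℙ; toSign)
import Data.Parity.Properties as ℙ
import Data.Product.Properties as Product
open import Data.Product.Base using (Σ; ∃-syntax; _×_; _,_; proj₁; proj₂)
import Data.Sign.Base as Sign
open import Data.Sign.Base using (Sign)
import Data.Sign.Properties as Sign
open import Data.Sum.Base using (_⊎_)
open import Data.Vec.Base using (Vec; []; _∷_; zipWith; replicate; map)
import Data.Vec.Properties as Vec
open import Data.Vec.Functional using (Vector)
open import Function.Base using (_∘_; id)
open import Function.Bundles using (mk⇔)
open import Level using (Level; _⊔_; 0ℓ) renaming (suc to lsuc)
open import Relation.Binary.Core using (Rel)
open import Relation.Binary.Definitions using (DecidableEquality)
open import Relation.Binary.PropositionalEquality as ≡
  using (_≡_; _≢_; refl; cong; cong₂; sym; trans)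
import Relation.Binary.Reasoning.Setoid as ≈-Reasoning
open import Relation.Binary.Structures using (IsStrictPartialOrder)
open import Relation.Nullary.Decidable using (does; does-⇔; yes; no; dec-true; dec-false)
open import Relation.Nullary.Negation using (¬_)
open import Relation.Unary using (Pred; _≐_)

------------------------------------------------------------------------
-- The real numbers

-- A Cauchy-complete Archimedean ordered field.  Classically this
-- determines ℝ up to unique isomorphism; constructively the Cauchy reals
-- are a model.  The square root is determined (on x ≥ 0) by the other
-- fields; it is included so that distances can be written down.

record RealField (c ℓ₁ ℓ₂ : Level) : Set (lsuc (c ⊔ ℓ₁ ⊔ ℓ₂)) where
  field
    commutativeRing : CommutativeRing c ℓ₁

  open CommutativeRing commutativeRing public
  open RawMonoidDefinitions +-rawMonoid public using (sum) renaming (_×_ to _·_)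

  infix 4 _<_ _≤_
  field
    _<_                  : Rel Carrier ℓ₂
    isStrictPartialOrder : IsStrictPartialOrder _≈_ _<_
    <-cotrans            : ∀ {x y} → x < y → ∀ z → x < z ⊎ z < y
    <-tight              : ∀ {x y} → ¬ (x < y) → ¬ (y < x) → x ≈ y
    0<1                  : 0# < 1#
    +-monoˡ-<            : ∀ {x y} z → x < y → x + z < y + z
    *-pos                : ∀ {x y} → 0# < x → 0# < y → 0# < x * y

    recip                : ∀ x → 0# < x → Carrier
    recip-inverse        : ∀ x (0<x : 0# < x) → x * recip x 0<x ≈ 1#

    archimedean          : ∀ x → ∃[ n ] x < n · 1#

  _≤_ : Rel Carrier ℓ₂
  x ≤ y = ¬ (y < x)

  -- |x - y| < 1 / (p + 1), cleared of denominators
  Close : ℕ → Rel Carrier ℓ₂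
  Close p x y = (suc p · (x - y) < 1#) × (suc p · (y - x) < 1#)

  Cauchy : (ℕ → Carrier) → Set ℓ₂
  Cauchy s = ∀ p → ∃[ N ] (∀ m n → N ℕ.≤ m → N ℕ.≤ n → Close p (s m) (s n))

  ConvergesTo : (ℕ → Carrier) → Carrier → Set ℓ₂
  ConvergesTo s x = ∀ p → ∃[ N ] (∀ n → N ℕ.≤ n → Close p (s n) x)

  field
    complete : ∀ s → Cauchy s → ∃[ x ] ConvergesTo s x

    √        : Carrier → Carrier
    √-cong   : ∀ {x y} → x ≈ y → √ x ≈ √ y
    √-nonneg : ∀ {x} → 0# ≤ x → 0# ≤ √ x
    √-square : ∀ {x} → 0# ≤ x → √ x * √ x ≈ x

  open IsStrictPartialOrder isStrictPartialOrder public
    using (<-respˡ-≈; <-respʳ-≈)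
    renaming (trans to <-trans; irrefl to <-irrefl; asym to <-asym)

  2# : Carrier
  2# = 1# + 1#

  0<2 : 0# < 2#
  0<2 = <-trans 0<1 (<-respˡ-≈ (+-identityˡ 1#) (+-monoˡ-< 1# 0<1))

  infixr 8 _^_
  _^_ : Carrier → ℕ → Carrier
  x ^ zero  = 1#
  x ^ suc n = x * x ^ n

  infix 9 2^_
  2^_ : ℤ → Carrier
  2^ (+ n)    = 2# ^ n
  2^ -[1+ n ] = recip 2# 0<2 ^ suc n

------------------------------------------------------------------------
-- Subspaces and dimension

module LinearAlgebra {k ℓk m ℓm : Level} {K : Ring k ℓk} (M : LeftModule K m ℓm) where
  private
    module K = Ring K
  open LeftModule M
  open CommutativeMonoidSum +ᴹ-commutativeMonoid using (sum)

  record IsSubspace {p} (P : Pred Carrierᴹ p) : Set (k ⊔ m ⊔ ℓm ⊔ p) where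
    field
      respects  : ∀ {x y} → x ≈ᴹ y → P x → P y
      0-closed  : P 0ᴹ
      +-closed  : ∀ {x y} → P x → P y → P (x +ᴹ y)
      *ₗ-closed : ∀ a {x} → P x → P (a *ₗ x)

  linearCombination : ∀ {n} → Vector K.Carrier n → Vector Carrierᴹ n → Carrierᴹ
  linearCombination a b = sum (λ j → a j *ₗ b j)

  LinearlyIndependent : ∀ {n} → Vector Carrierᴹ n → Set (k ⊔ ℓk ⊔ ℓm)
  LinearlyIndependent b =
    ∀ a → linearCombination a b ≈ᴹ 0ᴹ → ∀ j → a j K.≈ K.0#

  record IsBasis {p n} (P : Pred Carrierᴹ p) (b : Vector Carrierᴹ n)
                 : Set (k ⊔ ℓk ⊔ m ⊔ ℓm ⊔ p) where
    field
      member      : ∀ j → P (b j)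
      independent : LinearlyIndependent b
      spanning    : ∀ {x} → P x → ∃[ a ] x ≈ᴹ linearCombination a b

  HasDimension : ∀ {p} → Pred Carrierᴹ p → ℕ → Set (k ⊔ ℓk ⊔ m ⊔ ℓm ⊔ p)
  HasDimension P n = Σ (Vector Carrierᴹ n) (IsBasis P)

------------------------------------------------------------------------
-- Grassmannian packings

module Grassmannians {c ℓ₁ ℓ₂ : Level} (R : RealField c ℓ₁ ℓ₂) where
  open RealField R

  infix 7 ℝ^_
  ℝ^_ : ℕ → LeftModule ring c ℓ₁
  ℝ^ m = record
    { Carrierᴹ = Vector Carrier m
    ; _≈ᴹ_ = λ v w → ∀ j → v j ≈ w j
    ; _+ᴹ_ = λ v w j → v j + w j
    ; _*ₗ_ = λ a v j → a * v j
    ; 0ᴹ = λ _ → 0#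
    ; -ᴹ_ = λ v j → - v j
    ; isLeftModule = record
      { isLeftSemimodule = record
        { +ᴹ-isCommutativeMonoid = record
          { isMonoid = record
            { isSemigroup = record
              { isMagma = record
                { isEquivalence = record
                  { refl = λ _ → ≈.refl
                  ; sym = λ p j → ≈.sym (p j)
                  ; trans = λ p q j → ≈.trans (p j) (q j)
                  }
                ; ∙-cong = λ p q j → +-cong (p j) (q j)
                }
              ; assoc = λ u v w j → +-assoc (u j) (v j) (w j)
              }
            ; identity = (λ v j → +-identityˡ (v j)) , (λ v j → +-identityʳ (v j))
            }
          ; comm = λ v w j → +-comm (v j) (w j)
          }
        ; isPreleftSemimodule = record
          { *ₗ-cong = λ p q j → *-cong p (q j)
          ; *ₗ-zeroˡ = λ v j → zeroˡ (v j)
          ; *ₗ-distribʳ = λ v a b j → distribʳ (v j) a b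
          ; *ₗ-identityˡ = λ v j → *-identityˡ (v j)
          ; *ₗ-assoc = λ a b v j → *-assoc a b (v j)
          ; *ₗ-zeroʳ = λ a j → zeroʳ a
          ; *ₗ-distribˡ = λ a v w j → distribˡ a (v j) (w j)
          }
        }
      ; -ᴹ‿cong = λ p j → -‿cong (p j)
      ; -ᴹ‿inverse = (λ v j → -‿inverseˡ (v j)) , (λ v j → -‿inverseʳ (v j))
      }
    }
    where module ≈ = CommutativeRing commutativeRing

  module _ {m : ℕ} where
    open LinearAlgebra (ℝ^ m) public

  ⟨_,_⟩ : ∀ {m} → Vector Carrier m → Vector Carrier m → Carrier
  ⟨ v , w ⟩ = sum (λ j → v j * w j)

  Matrix : ℕ → Set c
  Matrix m = Fin m → Fin m → Carrier

  _⊗_ : ∀ {m} → Matrix m → Matrix m → Matrix m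
  (A ⊗ B) x z = sum (λ y → A x y * B y z)

  _$_ : ∀ {m} → Matrix m → Vector Carrier m → Vector Carrier m
  (A $ v) x = ⟨ A x , v ⟩

  trace : ∀ {m} → Matrix m → Carrier
  trace A = sum (λ x → A x x)

  record IsOrthogonalProjection {m p} (P : Pred (Vector Carrier m) p) (Π : Matrix m)
                                : Set (c ⊔ ℓ₁ ⊔ p) where
    field
      range      : ∀ v → P (Π $ v)
      orthogonal : ∀ v {w} → P w → ⟨ (λ j → v j - (Π $ v) j) , w ⟩ ≈ 0#

  -- A subspace has at most one orthogonal projection and, classically, a
  -- finite-dimensional one has exactly one; constructively its existence
  -- is extra data.  Planes are compared by _≐_ of their subspaces.
  record Grassmannian (m n : ℕ) : Set (lsuc ℓ₁ ⊔ c) where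
    field
      subspace     : Pred (Vector Carrier m) ℓ₁
      isSubspace   : IsSubspace subspace
      dimension    : HasDimension subspace n
      projection   : Matrix m
      isProjection : IsOrthogonalProjection subspace projection

  open Grassmannian public

  -- n - trace (Π_P Π_Q) is the sum of sin² over the principal angles.
  distance : ∀ {m n} → Grassmannian m n → Grassmannian m n → Carrier
  distance {n = n} P Q = √ (n · 1# - trace (projection P ⊗ projection Q))

  record Packing (N m n : ℕ) : Set (lsuc ℓ₁ ⊔ c) where
    field
      plane    : Fin N → Grassmannian m n
      distinct : ∀ {a b} → a ≢ b → ¬ (subspace (plane a) ≐ subspace (plane b))

  open Packing public

  record IsMinimalDistance {N m n} (𝒫 : Packing N m n) (d : Carrier)
                           : Set (ℓ₁ ⊔ ℓ₂) where
    field
      lowerBound : ∀ a b → a ≢ b → d ≤ distance (plane 𝒫 a) (plane 𝒫 b)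
      attained   : ∃[ a ] ∃[ b ] (a ≢ b × d ≈ distance (plane 𝒫 a) (plane 𝒫 b))

------------------------------------------------------------------------
-- The group E and the orthogonal space Ē

𝔽₂ : Ring 0ℓ 0ℓ
𝔽₂ = ℙ.+-*-ring

U : ℕ → Set
U = Vec Parity

infixl 6 _⊕_
_⊕_ : ∀ {i} → U i → U i → U i
_⊕_ = zipWith ℙ._+_

infixl 8 _∙_
_∙_ : ∀ {i} → U i → U i → Parity
[]      ∙ []      = 0ℙ
(p ∷ u) ∙ (q ∷ w) = p ℙ.* q ℙ.+ u ∙ w

𝟎 : ∀ {i} → U i
𝟎 = replicate _ 0ℙ

𝔽₂^_ : ℕ → LeftModule 𝔽₂ 0ℓ 0ℓ
𝔽₂^ i = record
  { Carrierᴹ = U i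
  ; _≈ᴹ_ = _≡_
  ; _+ᴹ_ = _⊕_
  ; _*ₗ_ = λ p → map (p ℙ.*_)
  ; 0ᴹ = 𝟎
  ; -ᴹ_ = id
  ; isLeftModule = record
    { isLeftSemimodule = record
      { +ᴹ-isCommutativeMonoid = record
        { isMonoid = record
          { isSemigroup = record
            { isMagma = record
              { isEquivalence = ≡.isEquivalence
              ; ∙-cong = cong₂ _⊕_
              }
            ; assoc = Vec.zipWith-assoc ℙ.+-assoc
            }
          ; identity = Vec.zipWith-identityˡ (λ _ → refl)
                     , Vec.zipWith-identityʳ ℙ.+-identityʳ
          }
        ; comm = Vec.zipWith-comm ℙ.+-comm
        }
      ; isPreleftSemimodule = record
        { *ₗ-cong = cong₂ (λ p → map (p ℙ.*_))
        ; *ₗ-zeroˡ = λ u → Vec.map-const u 0ℙ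
        ; *ₗ-distribʳ = distribʳ
        ; *ₗ-identityˡ = Vec.map-id
        ; *ₗ-assoc = assoc
        ; *ₗ-zeroʳ = λ p → trans (Vec.map-replicate (p ℙ.*_) 0ℙ _)
                                 (cong (replicate _) (ℙ.*-zeroʳ p))
        ; *ₗ-distribˡ = distribˡ
        }
      }
    ; -ᴹ‿cong = id
    ; -ᴹ‿inverse = self-inverse , self-inverse
    }
  }
  where
  distribʳ : ∀ {i} (u : U i) p q →
             map ((p ℙ.+ q) ℙ.*_) u ≡ map (p ℙ.*_) u ⊕ map (q ℙ.*_) u
  distribʳ []      p q = refl
  distribʳ (x ∷ u) p q = cong₂ _∷_ (ℙ.*-distribʳ-+ x p q) (distribʳ u p q)

  distribˡ : ∀ {i} p (u w : U i) →
             map (p ℙ.*_) (u ⊕ w) ≡ map (p ℙ.*_) u ⊕ map (p ℙ.*_) w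
  distribˡ p []      []      = refl
  distribˡ p (x ∷ u) (y ∷ w) = cong₂ _∷_ (ℙ.*-distribˡ-+ p x y) (distribˡ p u w)

  assoc : ∀ {i} p q (u : U i) → map ((p ℙ.* q) ℙ.*_) u ≡ map (p ℙ.*_) (map (q ℙ.*_) u)
  assoc p q []      = refl
  assoc p q (x ∷ u) = cong₂ _∷_ (ℙ.*-assoc p q x) (assoc p q u)

  self-inverse : ∀ {i} (u : U i) → u ⊕ u ≡ 𝟎
  self-inverse []      = refl
  self-inverse (p ∷ u) = cong₂ _∷_ (ℙ.p+p≡0ℙ p) (self-inverse u)

-- (s , a , b) stands for the transformation s X(a) Y(b) of V, given by
-- ⟦_⟧ below; distinct triples give distinct transformations.
E : ℕ → Set
E i = Sign × U i × U i

I -I : ∀ {i} → E i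
I  = Sign.+ , 𝟎 , 𝟎
-I = Sign.- , 𝟎 , 𝟎

-- Y(b) X(a′) = (-1)^(b ∙ a′) X(a′) Y(b)
infixl 7 _∘ᴱ_
_∘ᴱ_ : ∀ {i} → E i → E i → E i
(s , a , b) ∘ᴱ (s′ , a′ , b′) =
  s Sign.* s′ Sign.* toSign (b ∙ a′) , a ⊕ a′ , b ⊕ b′

infix 4 _≟ᴱ_
_≟ᴱ_ : ∀ {i} → DecidableEquality (E i)
_≟ᴱ_ = Product.≡-dec Sign._≟_ (Product.≡-dec (Vec.≡-dec ℙ._≟_) (Vec.≡-dec ℙ._≟_))

-- E / {±I}: (a , b) is the class of ± X(a) Y(b).
Ē : ℕ → LeftModule 𝔽₂ 0ℓ 0ℓ
Ē i = DirectProduct.leftModule (𝔽₂^ i) (𝔽₂^ i)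

∣Ē∣ : ℕ → Set
∣Ē∣ i = LeftModule.Carrierᴹ (Ē i)

bar : ∀ {i} → E i → ∣Ē∣ i
bar = proj₂

Preimage : ∀ {i} → Pred (∣Ē∣ i) 0ℓ → Pred (E i) 0ℓ
Preimage S̄ g = S̄ (bar g)

-- The square of either preimage of x is I or -I (see square below).
Q : ∀ {i} → ∣Ē∣ i → Parity
Q x = if does (g ∘ᴱ g ≟ᴱ I) then 0ℙ else 1ℙ
  where g = Sign.+ , x

∙-comm : ∀ {i} (u w : U i) → u ∙ w ≡ w ∙ u
∙-comm []      []      = refl
∙-comm (p ∷ u) (q ∷ w) = cong₂ ℙ._+_ (ℙ.*-comm p q) (∙-comm u w)

∙-distribˡ-⊕ : ∀ {i} (u w x : U i) → u ∙ (w ⊕ x) ≡ u ∙ w ℙ.+ u ∙ x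
∙-distribˡ-⊕ []      []      []      = refl
∙-distribˡ-⊕ (p ∷ u) (q ∷ w) (r ∷ x) = trans
  (cong₂ ℙ._+_ (ℙ.*-distribˡ-+ p q r) (∙-distribˡ-⊕ u w x))
  (+-interchange (p ℙ.* q) (p ℙ.* r) (u ∙ w) (u ∙ x))
  where open CommutativeSemigroupProperties ℙ.+-commutativeSemigroup
          renaming (interchange to +-interchange)

∙-distribʳ-⊕ : ∀ {i} (u w x : U i) → (w ⊕ x) ∙ u ≡ w ∙ u ℙ.+ x ∙ u
∙-distribʳ-⊕ u w x = trans (∙-comm (w ⊕ x) u)
  (trans (∙-distribˡ-⊕ u w x) (cong₂ ℙ._+_ (∙-comm u w) (∙-comm u x)))

square : ∀ {i} (x : ∣Ē∣ i) → let (a , b) = x in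
         (Sign.+ , x) ∘ᴱ (Sign.+ , x) ≡ (toSign (b ∙ a) , 𝟎 , 𝟎)
square (a , b) = cong₂ (λ u w → toSign (b ∙ a) , u , w) (-ᴹ‿inverseʳ a) (-ᴹ‿inverseʳ b)
  where open LeftModule (𝔽₂^ _)

Q-formula : ∀ {i} (a b : U i) → Q (a , b) ≡ a ∙ b
Q-formula {i} a b = trans
  (cong (λ g → if does (g ≟ᴱ I) then 0ℙ else 1ℙ) (square (a , b)))
  (trans (helper (b ∙ a)) (∙-comm b a))
  where
  helper : ∀ p → (if does ((toSign p , 𝟎 , 𝟎) ≟ᴱ I {i}) then 0ℙ else 1ℙ) ≡ p
  helper 0ℙ = cong (if_then 0ℙ else 1ℙ) (dec-true (I {i} ≟ᴱ I) refl)
  helper 1ℙ = cong (if_then 0ℙ else 1ℙ) (dec-false (-I {i} ≟ᴱ I) λ ())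

module _ {i : ℕ} where
  open LinearAlgebra (Ē i) public using () renaming
    (IsSubspace to IsĒSubspace; HasDimension to HasĒDimension)

TotallySingular : ∀ {i} → Pred (∣Ē∣ i) 0ℓ → Set
TotallySingular S̄ = ∀ x → S̄ x → Q x ≡ 0ℙ

-- A character of S is given by any function on E that is multiplicative
-- on S; its values outside S play no role below.
IsCharacter : ∀ {i} → Pred (E i) 0ℓ → (E i → Sign) → Set
IsCharacter S χ = ∀ g h → S g → S h → χ (g ∘ᴱ h) ≡ χ g Sign.* χ h

------------------------------------------------------------------------
-- The bijection between U and the coordinates of ℝ^(2^i)

fromParity : Parity → Fin 2
fromParity 0ℙ = zero
fromParity 1ℙ = suc zero

toParity : Fin 2 → Parity
toParity zero       = 0ℙ
toParity (suc zero) = 1ℙ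

toParity-fromParity : ∀ p → toParity (fromParity p) ≡ p
toParity-fromParity 0ℙ = refl
toParity-fromParity 1ℙ = refl

fromParity-toParity : ∀ j → fromParity (toParity j) ≡ j
fromParity-toParity zero       = refl
fromParity-toParity (suc zero) = refl

index : ∀ {i} → U i → Fin (2 ℕ.^ i)
index []      = zero
index (p ∷ u) = combine (fromParity p) (index u)

label : ∀ {i} → Fin (2 ℕ.^ i) → U i
label {zero}  _ = []
label {suc i} j = toParity (quotient (2 ℕ.^ i) j) ∷ label (remainder {2} (2 ℕ.^ i) j)

label-index : ∀ {i} (u : U i) → label (index u) ≡ u
label-index []                = refl
label-index {suc i} (p ∷ u) = cong₂ _∷_
  (trans (cong (toParity ∘ proj₁) (remQuot-combine (fromParity p) (index u)))
         (toParity-fromParity p))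
  (trans (cong (label ∘ proj₂) (remQuot-combine (fromParity p) (index u)))
         (label-index u))

index-label : ∀ {i} (j : Fin (2 ℕ.^ i)) → index {i} (label j) ≡ j
index-label {zero}  zero = refl
index-label {suc i} j    = trans
  (cong₂ combine (fromParity-toParity (quotient (2 ℕ.^ i) j))
                 (index-label {i} (remainder {2} (2 ℕ.^ i) j)))
  (combine-remQuot {2} (2 ℕ.^ i) j)

------------------------------------------------------------------------
-- The action of E on V = ℝ^(2^i), and invariant subspaces

module Clifford {c ℓ₁ ℓ₂ : Level} (R : RealField c ℓ₁ ℓ₂) (i : ℕ) where
  open RealField R hiding (refl; sym; trans)
  open Grassmannians R
  private
    module ≈ = RealField R

  V : Set c
  V = Vector Carrier (2 ℕ.^ i)

  infix 4 _≋_
  _≋_ : Rel V ℓ₁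
  _≋_ = LeftModule._≈ᴹ_ (ℝ^ (2 ℕ.^ i))

  e : U i → V
  e u j = if does (index u ≟ j) then 1# else 0#

  infixr 8 _⊙_
  _⊙_ : Sign → Carrier → Carrier
  Sign.+ ⊙ x = x
  Sign.- ⊙ x = - x

  X Y : U i → V → V
  X a v j = v (index (label j ⊕ a))
  Y b v j = toSign (b ∙ label j) ⊙ v j

  ⟦_⟧ : E i → V → V
  ⟦ s , a , b ⟧ v j = s ⊙ X a (Y b v) j

  ⊙-cong : ∀ s {x y} → x ≈ y → s ⊙ x ≈ s ⊙ y
  ⊙-cong Sign.+ p = p
  ⊙-cong Sign.- p = -‿cong p

  ⊙-assoc : ∀ s t x → (s Sign.* t) ⊙ x ≈ s ⊙ t ⊙ x
  ⊙-assoc Sign.+ t      x = ≈.refl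
  ⊙-assoc Sign.- Sign.+ x = ≈.refl
  ⊙-assoc Sign.- Sign.- x = ≈.sym (-‿involutive x)
    where open RingProperties ring

  ⊕-assoc : (u w x : U i) → (u ⊕ w) ⊕ x ≡ u ⊕ (w ⊕ x)
  ⊕-assoc = LeftModule.+ᴹ-assoc (𝔽₂^ i)

  ⊕-self : (u : U i) → u ⊕ u ≡ 𝟎
  ⊕-self = LeftModule.-ᴹ‿inverseʳ (𝔽₂^ i)

  ⊕-identityʳ : (u : U i) → u ⊕ 𝟎 ≡ u
  ⊕-identityʳ = LeftModule.+ᴹ-identityʳ (𝔽₂^ i)

  ⊕-cancel : (u a : U i) → (u ⊕ a) ⊕ a ≡ u
  ⊕-cancel u a = trans (⊕-assoc u a a) (trans (cong (u ⊕_) (⊕-self a)) (⊕-identityʳ u))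

  X-e : ∀ a u → X a (e u) ≋ e (u ⊕ a)
  X-e a u j = ≈.reflexive (cong (if_then 1# else 0#)
    (does-⇔ (mk⇔ to from) (index u ≟ index (label j ⊕ a)) (index (u ⊕ a) ≟ j)))
    where
    to : index u ≡ index (label j ⊕ a) → index (u ⊕ a) ≡ j
    to p = trans (cong (λ w → index (w ⊕ a))
                   (trans (sym (label-index u))
                     (trans (cong label p) (label-index (label j ⊕ a)))))
             (trans (cong index (⊕-cancel (label j) a)) (index-label {i} j))
    from : index (u ⊕ a) ≡ j → index u ≡ index (label j ⊕ a)
    from refl = cong index (sym
      (trans (cong (_⊕ a) (label-index (u ⊕ a))) (⊕-cancel u a)))

  Y-e : ∀ b u → Y b (e u) ≋ λ j → toSign (b ∙ u) ⊙ e u j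
  Y-e b u j with index u ≟ j
  ... | yes refl = ≈.reflexive (cong (λ w → toSign (b ∙ w) ⊙ 1#) (label-index u))
  ... | no  _    = ≈.trans (⊙-0 (toSign (b ∙ label j))) (≈.sym (⊙-0 (toSign (b ∙ u))))
    where
    open RingProperties ring
    ⊙-0 : ∀ s → s ⊙ 0# ≈ 0#
    ⊙-0 Sign.+ = ≈.refl
    ⊙-0 Sign.- = -0#≈0#

  ⟦⟧-∘ : ∀ g h v → ⟦ g ∘ᴱ h ⟧ v ≋ ⟦ g ⟧ (⟦ h ⟧ v)
  ⟦⟧-∘ (s , a , b) (s′ , a′ , b′) v j = begin
    (s Sign.* s′ Sign.* σ (b ∙ a′)) ⊙ σ ((b ⊕ b′) ∙ label J) ⊙ v J
      ≈⟨ ⊙-assoc (s Sign.* s′ Sign.* σ (b ∙ a′)) _ (v J) ⟨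
    (s Sign.* s′ Sign.* σ (b ∙ a′) Sign.* σ ((b ⊕ b′) ∙ label J)) ⊙ v J
      ≡⟨ cong (_⊙ v J) signs ⟩
    (s Sign.* (σ (b ∙ label K) Sign.* (s′ Sign.* σ (b′ ∙ label J)))) ⊙ v J
      ≈⟨ ⊙-assoc s _ (v J) ⟩
    s ⊙ (σ (b ∙ label K) Sign.* (s′ Sign.* σ (b′ ∙ label J))) ⊙ v J
      ≈⟨ ⊙-cong s (⊙-assoc (σ (b ∙ label K)) _ (v J)) ⟩
    s ⊙ σ (b ∙ label K) ⊙ (s′ Sign.* σ (b′ ∙ label J)) ⊙ v J
      ≈⟨ ⊙-cong s (⊙-cong (σ (b ∙ label K)) (⊙-assoc s′ _ (v J))) ⟩
    s ⊙ σ (b ∙ label K) ⊙ s′ ⊙ σ (b′ ∙ label J) ⊙ v J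
      ≡⟨ cong (λ L → s ⊙ σ (b ∙ label K) ⊙ s′ ⊙ σ (b′ ∙ label L) ⊙ v L) J≡L ⟩
    s ⊙ σ (b ∙ label K) ⊙ s′ ⊙ σ (b′ ∙ label L) ⊙ v L ∎
    where
    open ≈-Reasoning setoid
    σ = toSign
    J = index (label {i} j ⊕ (a ⊕ a′))
    K = index (label {i} j ⊕ a)
    L = index (label K ⊕ a′)

    J≡L : J ≡ L
    J≡L = cong index (trans (sym (⊕-assoc (label j) a a′))
                            (cong (_⊕ a′) (sym (label-index (label j ⊕ a)))))

    label-J : label J ≡ label K ⊕ a′
    label-J = trans (cong label J≡L) (label-index (label K ⊕ a′))

    x = b ∙ label {i} K
    y = b ∙ a′
    z = b′ ∙ label {i} J

    signs : s Sign.* s′ Sign.* σ y Sign.* σ ((b ⊕ b′) ∙ label J)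
          ≡ s Sign.* (σ x Sign.* (s′ Sign.* σ z))
    signs = let open CommutativeMonoidSolver Sign.*-commutativeMonoid using (solve; _⊜_) renaming (_⊕_ to _:*_) in
      trans (cong (λ p → s Sign.* s′ Sign.* σ y Sign.* σ p)
              (trans (∙-distribʳ-⊕ (label J) b b′)
                (cong (ℙ._+ z) (trans (cong (b ∙_) label-J) (∙-distribˡ-⊕ b (label K) a′)))))
      (trans (cong (s Sign.* s′ Sign.* σ y Sign.*_)
               (trans (ℙ.+-homo-* (x ℙ.+ y) z) (cong (Sign._* σ z) (ℙ.+-homo-* x y))))
      (trans (solve 5 (λ s s′ x y z → (((s :* s′) :* y) :* ((x :* y) :* z))
                                     ⊜ ((s :* (x :* (s′ :* z))) :* (y :* y)))
                refl s s′ (σ x) (σ y) (σ z))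
      (trans (cong ((s Sign.* (σ x Sign.* (s′ Sign.* σ z))) Sign.*_) (Sign.s*s≡+ (σ y)))
             (Sign.*-identityʳ _))))

  Eigenspace : Pred (E i) 0ℓ → (E i → Sign) → Pred V ℓ₁
  Eigenspace S χ v = ∀ g → S g → ⟦ g ⟧ v ≋ (λ j → χ g ⊙ v j)

  record IsInvariantSubspace (S : Pred (E i) 0ℓ) (P : Pred V ℓ₁) : Set (c ⊔ ℓ₁) where
    field
      χ           : E i → Sign
      isCharacter : IsCharacter S χ
      χ-I         : χ -I ≡ Sign.-
      eigenspace  : P ≐ Eigenspace S χ

{-# OPTIONS --safe #-}
module Submission where

-- The invariant subspace of a character χ of S is the range of the projection
-- Π = |S̄|⁻¹ ∑ χ(g) g, where g runs over one preimage of each element of S̄.  As tr g = 0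
-- unless g = ± I, tr (Π Π′) is 2^i |S̄|⁻¹ |S̄′|⁻¹ times a sum of signs over S̄ ∩ S̄′.  This
-- sum is at most |S̄ ∩ S̄′|, and it is 0 if S̄ = S̄′ and χ ≠ χ′; hence the distances.  If
-- Π = Π′ then it equals |S̄|, so that S̄ ∩ S̄′ = S̄ and all signs are +; hence distinctness.
-- Any two columns of Π are orthogonal or equal up to sign, so some of the columns form an
-- orthogonal basis of the range, and their number is tr Π = 2^(i-r).

open import Defs
open import Algebra.Module.Bundles using (LeftModule)
import Algebra.Properties.CommutativeMonoid.Sum as CommutativeMonoidSum
import Algebra.Properties.CommutativeSemigroup as CommutativeSemigroupProperties
import Algebra.Properties.Monoid.Mult as MonoidMult
import Algebra.Properties.Ring as RingProperties
import Algebra.Properties.Semiring.Sum as SemiringSum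
open import Data.Bool.Base using (if_then_else_)
open import Data.Fin.Base using (Fin; zero; suc; combine; quotient; remainder)
import Data.Fin.Permutation as Perm
open import Data.Fin.Properties using (_≟_; any?; remQuot-combine; combine-remQuot)
open import Data.Integer.Base using (+_; _⊖_) renaming (_-_ to _-ℤ_)
import Data.Integer.Properties as ℤ
open import Data.Nat.Base as ℕ using (ℕ; zero; suc; _∸_) renaming (_+_ to _+ℕ_; _*_ to _*ℕ_; _^_ to _^ℕ_; _≤_ to _≤ℕ_)
import Data.Nat.Properties as ℕ
import Data.Parity.Base as ℙ
open import Data.Parity.Base using (Parity; 0ℙ; 1ℙ; toSign; fromSign)
import Data.Parity.Properties as ℙ
open import Data.Product.Base using (Σ; ∃-syntax; _×_; _,_; proj₁; proj₂)
import Data.Product.Properties as Product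
import Data.Sign.Base as Sign
open import Data.Sign.Base using (Sign)
import Data.Sign.Properties as Sign
open import Data.Sum.Base as Sum using (_⊎_; inj₁; inj₂; [_,_])
open import Data.Vec.Base using ([]; _∷_; lookup; tabulate)
import Data.Vec.Properties as Vec
open import Data.Vec.Functional using (Vector) renaming (_∷_ to _∷ᶠ_)
open import Function.Base using (_∘_; id)
open import Level using (Level; _⊔_; 0ℓ)
open import Relation.Binary.Definitions using (DecidableEquality)
open import Relation.Binary.PropositionalEquality as ≡ using (_≡_; _≢_)
import Relation.Binary.Reasoning.Setoid as ≈-Reasoning
open import Relation.Nullary.Decidable using (Dec; does; yes; no; map′; _×-dec_)
open import Relation.Nullary.Negation using (¬_; contradiction)
open import Relation.Unary using (Pred; Decidable; _≐_; _∩_)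
open import Relation.Unary.Properties using (≐-sym; ≐-trans)

-- The obstacle is that x ↦ (+ , x) is not a homomorphism on S̄: a product of two such elements
-- carries the sign (-1)^(b ∙ a′). Total singularity makes this bilinear cocycle alternating, not
-- zero. A character with χ(-I) = -1 is the same as a function on S̄ whose failure to be additive is
-- this cocycle. In characteristic 2 such a function cannot be had by halving the form; one is built
-- coordinate by coordinate, and the others differ from it by linear forms, which accounts for the
-- 2^r planes of each space. The subspaces are bare predicates, and equality of real numbers is not
-- decidable. Every decision is therefore moved to a finite search through vectors over 𝔽₂; for the
-- choice of a basis this works because the elements of E are signed permutations. Distinctness
-- cannot be read off from the distances: for ℓ ≥ i - k the bound is not positive. The square root
-- is controlled on non-negative numbers only, so the trace of a product must also be bounded by
-- 2^k, whatever ℓ is.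

module _ {n : ℕ} where
  open LeftModule (𝔽₂^ n) public using () renaming
    ( +ᴹ-assoc to ⊕-assoc; +ᴹ-comm to ⊕-comm
    ; +ᴹ-identityˡ to ⊕-identityˡ; +ᴹ-identityʳ to ⊕-identityʳ
    ; -ᴹ‿inverseʳ to ⊕-self)

-- Vectors and linear forms over 𝔽₂

⊕-cancelʳ : ∀ {n} (u a : U n) → (u ⊕ a) ⊕ a ≡ u
⊕-cancelʳ u a = ≡.trans (⊕-assoc u a a) (≡.trans (≡.cong (u ⊕_) (⊕-self a)) (⊕-identityʳ u))

⊕-cancelˡ : ∀ {n} (a u : U n) → a ⊕ (a ⊕ u) ≡ u
⊕-cancelˡ a u = ≡.trans (≡.sym (⊕-assoc a a u)) (≡.trans (≡.cong (_⊕ u) (⊕-self a)) (⊕-identityˡ u))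

⊕≡𝟎⇒≡ : ∀ {n} {u w : U n} → u ⊕ w ≡ 𝟎 → u ≡ w
⊕≡𝟎⇒≡ {u = u} {w} p = ≡.trans (≡.sym (⊕-cancelʳ u w)) (≡.trans (≡.cong (_⊕ w) p) (⊕-identityˡ w))

∙-zeroʳ : ∀ {n} (u : U n) → u ∙ 𝟎 ≡ 0ℙ
∙-zeroʳ []      = ≡.refl
∙-zeroʳ (p ∷ u) = ≡.cong₂ ℙ._+_ (ℙ.*-zeroʳ p) (∙-zeroʳ u)

p+p+q≡q : ∀ p q → p ℙ.+ (p ℙ.+ q) ≡ q
p+p+q≡q p q = ≡.trans (≡.sym (ℙ.+-assoc p p q)) (≡.cong (ℙ._+ q) (ℙ.p+p≡0ℙ p))

p+q≡0⇒p≡q : ∀ p q → p ℙ.+ q ≡ 0ℙ → p ≡ q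
p+q≡0⇒p≡q 0ℙ 0ℙ _ = ≡.refl
p+q≡0⇒p≡q 1ℙ 1ℙ _ = ≡.refl

-- Nondegeneracy of the dot product; the witness is the unit vector at the first nonzero coordinate
-- of `t`.
separating-vector : ∀ {n} (t : U n) → t ≢ 𝟎 → ∃[ a ] t ∙ a ≡ 1ℙ
separating-vector []       t≢𝟎 = contradiction ≡.refl t≢𝟎
separating-vector (1ℙ ∷ t) _   = 1ℙ ∷ 𝟎 , ≡.cong (1ℙ ℙ.+_) (∙-zeroʳ t)
separating-vector (0ℙ ∷ t) t≢𝟎 with separating-vector t (t≢𝟎 ∘ ≡.cong (0ℙ ∷_))
... | a , t∙a≡1 = 0ℙ ∷ a , t∙a≡1

Additive : ∀ {n} → (U n → Parity) → Set
Additive f = ∀ u w → f (u ⊕ w) ≡ f u ℙ.+ f w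

additive-𝟎 : ∀ {n} (f : U n → Parity) → Additive f → f 𝟎 ≡ 0ℙ
additive-𝟎 f additive = ≡.trans (≡.cong f (≡.sym (⊕-self 𝟎)))
                                (≡.trans (additive 𝟎 𝟎) (ℙ.p+p≡0ℙ (f 𝟎)))

head-tail : ∀ {n} x (u : U n) → x ∷ u ≡ (x ∷ 𝟎) ⊕ (0ℙ ∷ u)
head-tail x u = ≡.cong₂ _∷_ (≡.sym (ℙ.+-identityʳ x)) (≡.sym (⊕-identityˡ u))

-- Over 𝔽₂ additivity is linearity, so `t` collects the values of `f` on the unit vectors.
additive⇒∙ : ∀ {n} (f : U n → Parity) → Additive f → ∃[ t ] ∀ u → f u ≡ t ∙ u
additive⇒∙ {zero}  f additive = [] , λ { [] → additive-𝟎 f additive }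
additive⇒∙ {suc n} f additive
  with additive⇒∙ (f ∘ (0ℙ ∷_)) (λ u w → additive (0ℙ ∷ u) (0ℙ ∷ w))
... | t , f≡t∙ = f (1ℙ ∷ 𝟎) ∷ t , λ { (x ∷ u) → ≡.trans (≡.cong f (head-tail x u))
                   (≡.trans (additive (x ∷ 𝟎) (0ℙ ∷ u)) (≡.cong₂ ℙ._+_ (first x) (f≡t∙ u))) }
  where
  first : ∀ x → f (x ∷ 𝟎) ≡ f (1ℙ ∷ 𝟎) ℙ.* x
  first 0ℙ = ≡.trans (additive-𝟎 f additive) (≡.sym (ℙ.*-zeroʳ (f (1ℙ ∷ 𝟎))))
  first 1ℙ = ≡.sym (ℙ.*-identityʳ (f (1ℙ ∷ 𝟎)))

-- Quadratic refinements of alternating forms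

-- The polarisation identity of a quadratic form. Read multiplicatively, (-1)^q has the cocycle
-- (-1)^β as its coboundary.
IsRefinement : ∀ {n} → (U n → U n → Parity) → (U n → Parity) → Set
IsRefinement β q = ∀ u w → q (u ⊕ w) ≡ q u ℙ.+ q w ℙ.+ β u w

module _ where
  open CommutativeSemigroupProperties ℙ.+-commutativeSemigroup using (interchange)

  -- Expand β(u + w, u + w) = 0: the two mixed terms sum to zero, hence agree in characteristic 2.
  alternating⇒symmetric : ∀ {n} (β : U n → U n → Parity) →
    (∀ u → Additive (β u)) → (∀ w → Additive (λ u → β u w)) → (∀ u → β u u ≡ 0ℙ) →
    ∀ u w → β u w ≡ β w u
  alternating⇒symmetric β addʳ addˡ alt u w = p+q≡0⇒p≡q _ _ (begin
    β u w ℙ.+ β w u                              ≡⟨ ≡.cong₂ ℙ._+_ (≡.cong (ℙ._+ β u w) (alt u)) (≡.trans (≡.cong (β w u ℙ.+_) (alt w)) (ℙ.+-identityʳ _)) ⟨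
    (β u u ℙ.+ β u w) ℙ.+ (β w u ℙ.+ β w w)      ≡⟨ ≡.cong₂ ℙ._+_ (addʳ u u w) (addʳ w u w) ⟨
    β u (u ⊕ w) ℙ.+ β w (u ⊕ w)                  ≡⟨ addˡ (u ⊕ w) u w ⟨
    β (u ⊕ w) (u ⊕ w)                            ≡⟨ alt (u ⊕ w) ⟩
    0ℙ                                           ∎)
    where open ≡.≡-Reasoning

  -- The recursion yields the sum of β(e_j, e_k) u_j u_k over j < k, the upper triangle of the
  -- matrix of β. It replaces the quotient β(u, u)/2 of other characteristics.
  quadratic-refinement : ∀ {n} (β : U n → U n → Parity) →
    (∀ u → Additive (β u)) → (∀ w → Additive (λ u → β u w)) → (∀ u → β u u ≡ 0ℙ) →
    Σ (U n → Parity) (IsRefinement β)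
  quadratic-refinement {zero}  β addʳ addˡ alt = (λ _ → 0ℙ) , λ { [] [] → ≡.sym (alt []) }
  quadratic-refinement {suc n} β addʳ addˡ alt
    with quadratic-refinement (λ u w → β (0ℙ ∷ u) (0ℙ ∷ w))
           (λ u v w → addʳ (0ℙ ∷ u) (0ℙ ∷ v) (0ℙ ∷ w))
           (λ u v w → addˡ (0ℙ ∷ u) (0ℙ ∷ v) (0ℙ ∷ w)) (λ u → alt (0ℙ ∷ u))
  ... | q , refines = q′ , refines′
    where
    open ≡.≡-Reasoning
    h : Parity → U (suc n)
    h x = x ∷ 𝟎
    t : U n → U (suc n)
    t u = 0ℙ ∷ u
    q′ : U (suc n) → Parity
    q′ (x ∷ u) = q u ℙ.+ β (h x) (t u)

    -- Both arguments lie on the line of the first unit vector, where an alternating form is zero.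
    h-alternating : ∀ x y → β (h x) (h y) ≡ 0ℙ
    h-alternating 0ℙ y  = additive-𝟎 (λ u → β u (h y)) (addˡ (h y))
    h-alternating 1ℙ 0ℙ = additive-𝟎 (β (h 1ℙ)) (addʳ (h 1ℙ))
    h-alternating 1ℙ 1ℙ = alt (h 1ℙ)

    cross : ∀ x y u w →
      β (h (x ℙ.+ y)) (t (u ⊕ w)) ≡
      (β (h x) (t u) ℙ.+ β (h y) (t w)) ℙ.+ (β (h x) (t w) ℙ.+ β (t u) (h y))
    cross x y u w = begin
      β (h (x ℙ.+ y)) (t (u ⊕ w))
        -- `h (x ℙ.+ y)` and `h x ⊕ h y` differ only in their tails 𝟎 and 𝟎 ⊕ 𝟎.
        ≡⟨ ≡.cong (λ z → β ((x ℙ.+ y) ∷ z) (t (u ⊕ w))) (⊕-self 𝟎) ⟨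
      β (h x ⊕ h y) (t u ⊕ t w)
        ≡⟨ addʳ _ (t u) (t w) ⟩
      β (h x ⊕ h y) (t u) ℙ.+ β (h x ⊕ h y) (t w)
        ≡⟨ ≡.cong₂ ℙ._+_ (addˡ (t u) (h x) (h y)) (≡.trans (addˡ (t w) (h x) (h y)) (ℙ.+-comm (β (h x) (t w)) _)) ⟩
      (β (h x) (t u) ℙ.+ β (h y) (t u)) ℙ.+ (β (h y) (t w) ℙ.+ β (h x) (t w))
        ≡⟨ interchange (β (h x) (t u)) (β (h y) (t u)) (β (h y) (t w)) (β (h x) (t w)) ⟩
      (β (h x) (t u) ℙ.+ β (h y) (t w)) ℙ.+ (β (h y) (t u) ℙ.+ β (h x) (t w))
        ≡⟨ ≡.cong ((β (h x) (t u) ℙ.+ β (h y) (t w)) ℙ.+_) (≡.trans (ℙ.+-comm (β (h y) (t u)) _)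
             (≡.cong (β (h x) (t w) ℙ.+_) (alternating⇒symmetric β addʳ addˡ alt (h y) (t u)))) ⟩
      (β (h x) (t u) ℙ.+ β (h y) (t w)) ℙ.+ (β (h x) (t w) ℙ.+ β (t u) (h y)) ∎

    expand : ∀ x y u w →
      β (x ∷ u) (y ∷ w) ≡ β (t u) (t w) ℙ.+ (β (h x) (t w) ℙ.+ β (t u) (h y))
    expand x y u w = begin
      β (x ∷ u) (y ∷ w)
        ≡⟨ ≡.cong₂ β (head-tail x u) (head-tail y w) ⟩
      β (h x ⊕ t u) (h y ⊕ t w)
        ≡⟨ addˡ _ (h x) (t u) ⟩
      β (h x) (h y ⊕ t w) ℙ.+ β (t u) (h y ⊕ t w)
        ≡⟨ ≡.cong₂ ℙ._+_ (addʳ (h x) (h y) (t w)) (addʳ (t u) (h y) (t w)) ⟩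
      (β (h x) (h y) ℙ.+ β (h x) (t w)) ℙ.+ (β (t u) (h y) ℙ.+ β (t u) (t w))
        ≡⟨ ≡.cong (λ z → (z ℙ.+ β (h x) (t w)) ℙ.+ (β (t u) (h y) ℙ.+ β (t u) (t w)))
             (h-alternating x y) ⟩
      β (h x) (t w) ℙ.+ (β (t u) (h y) ℙ.+ β (t u) (t w))
        ≡⟨ ℙ.+-assoc (β (h x) (t w)) _ _ ⟨
      (β (h x) (t w) ℙ.+ β (t u) (h y)) ℙ.+ β (t u) (t w)
        ≡⟨ ℙ.+-comm _ (β (t u) (t w)) ⟩
      β (t u) (t w) ℙ.+ (β (h x) (t w) ℙ.+ β (t u) (h y)) ∎

    refines′ : IsRefinement β q′
    refines′ (x ∷ u) (y ∷ w) = begin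
      q (u ⊕ w) ℙ.+ β (h (x ℙ.+ y)) (t (u ⊕ w))
        ≡⟨ ≡.cong₂ ℙ._+_ (refines u w) (cross x y u w) ⟩
      (q u ℙ.+ q w ℙ.+ β (t u) (t w)) ℙ.+
        ((β (h x) (t u) ℙ.+ β (h y) (t w)) ℙ.+ (β (h x) (t w) ℙ.+ β (t u) (h y)))
        ≡⟨ interchange (q u ℙ.+ q w) (β (t u) (t w)) _ _ ⟩
      ((q u ℙ.+ q w) ℙ.+ (β (h x) (t u) ℙ.+ β (h y) (t w))) ℙ.+
        (β (t u) (t w) ℙ.+ (β (h x) (t w) ℙ.+ β (t u) (h y)))
        ≡⟨ ≡.cong₂ ℙ._+_ (interchange (q u) (q w) _ _) (≡.sym (expand x y u w)) ⟩
      q′ (x ∷ u) ℙ.+ q′ (y ∷ w) ℙ.+ β (x ∷ u) (y ∷ w) ∎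

-- Coordinates on subspaces of Ē

infixl 6 _+ᴱ_
_+ᴱ_ : ∀ {i} → ∣Ē∣ i → ∣Ē∣ i → ∣Ē∣ i
(a , b) +ᴱ (a′ , b′) = a ⊕ a′ , b ⊕ b′

-- A linear isomorphism of the finite space `U r` with `P`. It makes sums over `P` and searches
-- through `P` possible although `P` is an arbitrary predicate.
record Coordinates {i} (P : Pred (∣Ē∣ i) 0ℓ) (r : ℕ) : Set where
  field
    vec        : U r → ∣Ē∣ i
    vec-⊕      : ∀ p q → vec (p ⊕ q) ≡ vec p +ᴱ vec q
    injective  : ∀ {p q} → vec p ≡ vec q → p ≡ q
    member     : ∀ p → P (vec p)
    surjective : ∀ {x} → P x → ∃[ p ] vec p ≡ x

module _ {i : ℕ} where
  private
    module M = LeftModule (Ē i)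
  open LinearAlgebra (Ē i)
  open CommutativeMonoidSum M.+ᴹ-commutativeMonoid using (sum; sum-cong-≋; ∑-distrib-+)

  linearCombination-closed : ∀ {P : Pred (∣Ē∣ i) 0ℓ} {n} → IsSubspace P →
    (a : Vector Parity n) (b : Vector (∣Ē∣ i) n) → (∀ j → P (b j)) → P (linearCombination a b)
  linearCombination-closed {n = zero}  isSub a b b∈P = IsSubspace.0-closed isSub
  linearCombination-closed {n = suc n} isSub a b b∈P = IsSubspace.+-closed isSub
    (IsSubspace.*ₗ-closed isSub (a zero) (b∈P zero))
    (linearCombination-closed isSub (a ∘ suc) (b ∘ suc) (b∈P ∘ suc))

  ≈ᴹ⇒≡ : ∀ {x y : ∣Ē∣ i} → x M.≈ᴹ y → x ≡ y
  ≈ᴹ⇒≡ (p , q) = ≡.cong₂ _,_ p q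

  coordinates : ∀ {P : Pred (∣Ē∣ i) 0ℓ} {r} → IsĒSubspace P → HasĒDimension P r → Coordinates P r
  coordinates {P} {r} isSub (b , isBasis) = record
    { vec        = vec
    ; vec-⊕      = vec-⊕
    ; injective  = injective
    ; member     = λ p → linearCombination-closed isSub (lookup p) b (IsBasis.member isBasis)
    ; surjective = surjective
    }
    where
    vec : U r → ∣Ē∣ i
    vec p = linearCombination (lookup p) b

    vec-⊕ : ∀ p q → vec (p ⊕ q) ≡ vec p +ᴱ vec q
    vec-⊕ p q = ≈ᴹ⇒≡ (M.≈ᴹ-trans
      (sum-cong-≋ (λ j → M.≈ᴹ-trans
        (M.*ₗ-congʳ (Vec.lookup-zipWith ℙ._+_ j p q))
        (M.*ₗ-distribʳ (b j) (lookup p j) (lookup q j))))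
      (∑-distrib-+ (λ j → lookup p j M.*ₗ b j) (λ j → lookup q j M.*ₗ b j)))

    injective : ∀ {p q} → vec p ≡ vec q → p ≡ q
    injective {p} {q} eq = ⊕≡𝟎⇒≡ (≡.trans (≡.sym (Vec.tabulate∘lookup (p ⊕ q)))
      (≡.trans (Vec.tabulate-cong (λ j → ≡.trans
               (IsBasis.independent isBasis (lookup (p ⊕ q)) vanishes j)
               (≡.sym (Vec.lookup-replicate j 0ℙ))))
             (Vec.tabulate∘lookup 𝟎)))
      where
      vanishes : vec (p ⊕ q) M.≈ᴹ M.0ᴹ
      vanishes = M.≈ᴹ-reflexive (≡.trans (vec-⊕ p q) (≡.trans (≡.cong (_+ᴱ vec q) eq)
                   (≡.cong₂ _,_ (⊕-self _) (⊕-self _))))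

    surjective : ∀ {x} → P x → ∃[ p ] vec p ≡ x
    surjective x∈P with IsBasis.spanning isBasis x∈P
    ... | a , x≈ = tabulate a , ≈ᴹ⇒≡ (M.≈ᴹ-trans
      (sum-cong-≋ (λ j → M.*ₗ-congʳ (Vec.lookup∘tabulate a j))) (M.≈ᴹ-sym x≈))

  ∩-isSubspace : ∀ {P P′ : Pred (∣Ē∣ i) 0ℓ} → IsĒSubspace P → IsĒSubspace P′ → IsĒSubspace (P ∩ P′)
  ∩-isSubspace S S′ = record
    { respects  = λ x≈y (p , p′) → IsSubspace.respects S x≈y p , IsSubspace.respects S′ x≈y p′
    ; 0-closed  = IsSubspace.0-closed S , IsSubspace.0-closed S′
    ; +-closed  = λ (p , p′) (q , q′) → IsSubspace.+-closed S p q , IsSubspace.+-closed S′ p′ q′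
    ; *ₗ-closed = λ a (p , p′) → IsSubspace.*ₗ-closed S a p , IsSubspace.*ₗ-closed S′ a p′
    }

-- Inequalities, powers of two and finite sums of real numbers

module RealFieldProperties {c ℓ₁ ℓ₂ : Level} (R : RealField c ℓ₁ ℓ₂) where
  open RealField R hiding (zero)
  open RingProperties ring
  open MonoidMult +-monoid using (×-homo-+)
  open SemiringSum semiring using (sum-cong-≋)
  open CommutativeSemigroupProperties *-commutativeSemigroup using (interchange)
  open ≈-Reasoning setoid

  ≈⇒≤ : ∀ {x y} → x ≈ y → x ≤ y
  ≈⇒≤ x≈y = <-irrefl (sym x≈y)

  -- As `≤` is the negation of `<`, a supposed strict inequality is split at the middle term by
  -- cotransitivity.
  ≤-trans : ∀ {x y z} → x ≤ y → y ≤ z → x ≤ z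
  ≤-trans {y = y} x≤y y≤z z<x = [ y≤z , x≤y ] (<-cotrans z<x y)

  <-≤-trans : ∀ {x y z} → x < y → y ≤ z → x < z
  <-≤-trans {z = z} x<y y≤z = [ id , (λ z<y → contradiction z<y y≤z) ] (<-cotrans x<y z)

  +-monoʳ-< : ∀ {x y} z → x < y → z + x < z + y
  +-monoʳ-< {x} {y} z x<y = <-respˡ-≈ (+-comm x z) (<-respʳ-≈ (+-comm y z) (+-monoˡ-< z x<y))

  +-cancelʳ-< : ∀ {x y} z → x + z < y + z → x < y
  +-cancelʳ-< {x} {y} z x+z<y+z = <-respˡ-≈ (shift x) (<-respʳ-≈ (shift y) (+-monoˡ-< (- z) x+z<y+z))
    where
    shift : ∀ w → w + z - z ≈ w
    shift w = trans (+-assoc w z (- z)) (trans (+-congˡ (-‿inverseʳ z)) (+-identityʳ w))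

  +-cancelˡ-< : ∀ {x y} z → z + x < z + y → x < y
  +-cancelˡ-< {x} {y} z z+x<z+y =
    +-cancelʳ-< z (<-respˡ-≈ (+-comm z x) (<-respʳ-≈ (+-comm z y) z+x<z+y))

  +-mono-≤ : ∀ {x y u v} → x ≤ y → u ≤ v → x + u ≤ y + v
  +-mono-≤ {x} {y} {u} {v} x≤y u≤v y+v<x+u =
    [ u≤v ∘ +-cancelˡ-< y , x≤y ∘ +-cancelʳ-< u ] (<-cotrans y+v<x+u (y + u))

  -‿mono-≤ : ∀ {x y} → x ≤ y → - y ≤ - x
  -‿mono-≤ {x} {y} x≤y -x<-y = x≤y (+-cancelʳ-< (- y)
    (<-respˡ-≈ (sym (-‿inverseʳ y)) (<-respˡ-≈ (-‿inverseʳ x) (+-monoʳ-< x -x<-y))))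

  0≤y-x : ∀ {x y} → x ≤ y → 0# ≤ y - x
  0≤y-x {x} {y} x≤y y-x<0 = x≤y (<-respʳ-≈ (+-identityˡ x) (<-respˡ-≈
    (trans (+-assoc y (- x) x) (trans (+-congˡ (-‿inverseˡ x)) (+-identityʳ y)))
    (+-monoˡ-< x y-x<0)))

  *-monoˡ-< : ∀ {a x y} → 0# < a → x < y → a * x < a * y
  *-monoˡ-< {a} {x} {y} 0<a x<y = +-cancelʳ-< (a * - x)
    (<-respˡ-≈ (trans (sym (zeroʳ a)) (trans (*-congˡ (sym (-‿inverseʳ x))) (distribˡ a x (- x))))
      (<-respʳ-≈ (distribˡ a y (- x)) (*-pos 0<a 0<y-x)))
    where
    0<y-x : 0# < y - x
    0<y-x = <-respˡ-≈ (-‿inverseʳ x) (+-monoˡ-< (- x) x<y)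

  *-cancel-inverse : ∀ {a b} → a * b ≈ 1# → ∀ x → a * (b * x) ≈ x
  *-cancel-inverse {a} {b} ab≈1 x = trans (sym (*-assoc a b x)) (trans (*-congʳ ab≈1) (*-identityˡ x))

  -- A violation b y < b x is multiplied back by `a`; hence the number assumed positive is the
  -- inverse `a` of the factor `b`.
  *-monoˡ-≤ : ∀ {a b x y} → 0# < a → a * b ≈ 1# → x ≤ y → b * x ≤ b * y
  *-monoˡ-≤ 0<a ab≈1 x≤y by<bx = x≤y (<-respˡ-≈ (*-cancel-inverse ab≈1 _)
    (<-respʳ-≈ (*-cancel-inverse ab≈1 _) (*-monoˡ-< 0<a by<bx)))

  *-cancelˡ : ∀ {a b x y} → b * a ≈ 1# → a * x ≈ a * y → x ≈ y
  *-cancelˡ ba≈1 ax≈ay = trans (sym (*-cancel-inverse ba≈1 _))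
    (trans (*-congˡ ax≈ay) (*-cancel-inverse ba≈1 _))

  ½ : Carrier
  ½ = recip 2# 0<2

  ½^*2^ : ∀ n → ½ ^ n * 2# ^ n ≈ 1#
  ½^*2^ zero    = *-identityˡ 1#
  ½^*2^ (suc n) = trans (interchange ½ (½ ^ n) 2# (2# ^ n))
    (trans (*-cong (trans (*-comm ½ 2#) (recip-inverse 2# 0<2)) (½^*2^ n)) (*-identityˡ 1#))

  2^*½^ : ∀ n → 2# ^ n * ½ ^ n ≈ 1#
  2^*½^ n = trans (*-comm _ _) (½^*2^ n)

  0<2^ : ∀ n → 0# < 2# ^ n
  0<2^ zero    = 0<1
  0<2^ (suc n) = *-pos 0<2 (0<2^ n)

  ½^-mono-≤ : ∀ n {x y} → x ≤ y → ½ ^ n * x ≤ ½ ^ n * y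
  ½^-mono-≤ n = *-monoˡ-≤ (0<2^ n) (2^*½^ n)

  -- The axioms give no sign for `recip`. Compare ½ with 0 < 1: either 0 < ½, or ½ < 1 and then ½ =
  -- 1 - ½ is positive.
  0<½ : 0# < ½
  0<½ with <-cotrans 0<1 ½
  ... | inj₁ 0<½ = 0<½
  ... | inj₂ ½<1 = <-respʳ-≈ 1-½≈½ (<-respˡ-≈ (-‿inverseʳ ½) (+-monoˡ-< (- ½) ½<1))
    where
    1-½≈½ : 1# - ½ ≈ ½
    1-½≈½ = begin
      1# - ½              ≈⟨ +-congʳ (recip-inverse 2# 0<2) ⟨
      2# * ½ - ½          ≈⟨ +-congʳ (distribʳ ½ 1# 1#) ⟩
      1# * ½ + 1# * ½ - ½ ≈⟨ +-congʳ (+-cong (*-identityˡ ½) (*-identityˡ ½)) ⟩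
      ½ + ½ - ½           ≈⟨ +-assoc ½ ½ (- ½) ⟩
      ½ + (½ - ½)         ≈⟨ +-congˡ (-‿inverseʳ ½) ⟩
      ½ + 0#              ≈⟨ +-identityʳ ½ ⟩
      ½                   ∎

  0<½^ : ∀ n → 0# < ½ ^ n
  0<½^ zero    = 0<1
  0<½^ (suc n) = *-pos 0<½ (0<½^ n)

  -- Because 2 is invertible. Sums and columns are shown to vanish by a symmetry that reverses their
  -- sign.
  x≈-x⇒x≈0 : ∀ {x} → x ≈ - x → x ≈ 0#
  x≈-x⇒x≈0 {x} x≈-x = *-cancelˡ (trans (*-comm ½ 2#) (recip-inverse 2# 0<2)) (begin
    2# * x          ≈⟨ distribʳ x 1# 1# ⟩
    1# * x + 1# * x ≈⟨ +-cong (*-identityˡ x) (trans (*-identityˡ x) x≈-x) ⟩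
    x - x           ≈⟨ -‿inverseʳ x ⟩
    0#              ≈⟨ zeroʳ 2# ⟨
    2# * 0#         ∎)

  ^-homo-+ : ∀ x m n → x ^ (m +ℕ n) ≈ x ^ m * x ^ n
  ^-homo-+ x zero    n = sym (*-identityˡ (x ^ n))
  ^-homo-+ x (suc m) n = trans (*-congˡ (^-homo-+ x m n)) (sym (*-assoc x (x ^ m) (x ^ n)))

  2^-mono-≤ : ∀ {m n} → m ≤ℕ n → 2# ^ m ≤ 2# ^ n
  2^-mono-≤ {m} m≤n with ℕ.≤⇒≤′ m≤n
  ... | m≤′n = go m≤′n
    where
    go : ∀ {n} → m ℕ.≤′ n → 2# ^ m ≤ 2# ^ n
    go ℕ.≤′-refl = ≈⇒≤ refl
    go (ℕ.≤′-step {n} m≤′n) = ≤-trans (go m≤′n) (≤-trans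
      (≈⇒≤ (sym (+-identityʳ _)))
      (≤-trans (+-mono-≤ (≈⇒≤ refl) (<-asym (0<2^ n)))
        (≈⇒≤ (sym (trans (distribʳ (2# ^ n) 1# 1#) (+-cong (*-identityˡ _) (*-identityˡ _)))))))

  2^ℕ·1 : ∀ n → (2 ^ℕ n) · 1# ≈ 2# ^ n
  2^ℕ·1 zero    = +-identityʳ 1#
  2^ℕ·1 (suc n) = begin
    (2 ^ℕ n +ℕ (2 ^ℕ n +ℕ 0)) · 1#    ≈⟨ ×-homo-+ 1# (2 ^ℕ n) (2 ^ℕ n +ℕ 0) ⟩
    (2 ^ℕ n) · 1# + (2 ^ℕ n +ℕ 0) · 1# ≡⟨ ≡.cong (λ m → (2 ^ℕ n) · 1# + m · 1#) (ℕ.+-identityʳ (2 ^ℕ n)) ⟩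
    (2 ^ℕ n) · 1# + (2 ^ℕ n) · 1#       ≈⟨ +-cong (2^ℕ·1 n) (2^ℕ·1 n) ⟩
    2# ^ n + 2# ^ n                       ≈⟨ +-cong (*-identityˡ _) (*-identityˡ _) ⟨
    1# * 2# ^ n + 1# * 2# ^ n             ≈⟨ distribʳ (2# ^ n) 1# 1# ⟨
    2# * 2# ^ n                           ∎

  ·1-nonneg : ∀ n → 0# ≤ n · 1#
  ·1-nonneg zero    = ≈⇒≤ refl
  ·1-nonneg (suc n) = ≤-trans (≈⇒≤ (sym (+-identityˡ 0#))) (+-mono-≤ (<-asym 0<1) (·1-nonneg n))

  -- Characteristic zero. It turns an equation between real traces into one between numbers of basis
  -- vectors.
  ·1-injective : ∀ m n → m · 1# ≈ n · 1# → m ≡ n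
  ·1-injective zero    zero    eq = ≡.refl
  ·1-injective zero    (suc n) eq = contradiction
    (<-≤-trans 0<1 (≤-trans (≈⇒≤ (sym (+-identityʳ 1#))) (+-mono-≤ (≈⇒≤ refl) (·1-nonneg n))))
    (≈⇒≤ (sym eq))
  ·1-injective (suc m) zero    eq = contradiction
    (<-≤-trans 0<1 (≤-trans (≈⇒≤ (sym (+-identityʳ 1#))) (+-mono-≤ (≈⇒≤ refl) (·1-nonneg m))))
    (≈⇒≤ eq)
  ·1-injective (suc m) (suc n) eq = ≡.cong suc (·1-injective m n (+-cancelˡ 1# _ _ eq))

  2^[m-n] : ∀ m n → 2^ (+ m -ℤ + n) ≈ ½ ^ n * 2# ^ m
  2^[m-n] m n = trans (reflexive (≡.cong 2^_ (ℤ.m-n≡m⊖n m n))) (2^[m⊖n] m n)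
    where
    2^[m⊖n] : ∀ m n → 2^ (m ⊖ n) ≈ ½ ^ n * 2# ^ m
    2^[m⊖n] m       zero    = sym (*-identityˡ (2# ^ m))
    2^[m⊖n] zero    (suc n) = sym (*-identityʳ (½ ^ suc n))
    2^[m⊖n] (suc m) (suc n) = begin
      2^ (suc m ⊖ suc n)          ≡⟨ ≡.cong 2^_ (ℤ.[1+m]⊖[1+n]≡m⊖n m n) ⟩
      2^ (m ⊖ n)                  ≈⟨ 2^[m⊖n] m n ⟩
      ½ ^ n * 2# ^ m              ≈⟨ *-identityˡ _ ⟨
      1# * (½ ^ n * 2# ^ m)       ≈⟨ *-congʳ (trans (*-comm ½ 2#) (recip-inverse 2# 0<2)) ⟨
      ½ * 2# * (½ ^ n * 2# ^ m)   ≈⟨ interchange ½ 2# (½ ^ n) (2# ^ m) ⟩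
      ½ ^ suc n * 2# ^ suc m      ∎

  sum-mono-≤ : ∀ {n} (f g : Fin n → Carrier) → (∀ j → f j ≤ g j) → sum f ≤ sum g
  sum-mono-≤ {zero}  f g f≤g = ≈⇒≤ refl
  sum-mono-≤ {suc n} f g f≤g = +-mono-≤ (f≤g zero) (sum-mono-≤ (f ∘ suc) (g ∘ suc) (f≤g ∘ suc))

  sum-zero : ∀ {n} (f : Fin n → Carrier) → (∀ j → f j ≈ 0#) → sum f ≈ 0#
  sum-zero {zero}  f f≈0 = refl
  sum-zero {suc n} f f≈0 = trans (+-cong (f≈0 zero) (sum-zero (f ∘ suc) (f≈0 ∘ suc))) (+-identityˡ 0#)

  sum-single : ∀ {n} (k : Fin n) (f : Fin n → Carrier) → (∀ j → j ≢ k → f j ≈ 0#) → sum f ≈ f k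
  sum-single zero    f f≈0 = trans (+-congˡ (sum-zero (f ∘ suc) (λ j → f≈0 (suc j) λ ()))) (+-identityʳ (f zero))
  sum-single (suc k) f f≈0 = trans
    (+-cong (f≈0 zero λ ()) (sum-single k (f ∘ suc) (λ j j≢k → f≈0 (suc j) (λ { ≡.refl → j≢k ≡.refl }))))
    (+-identityˡ (f (suc k)))

  sum-const-1 : ∀ n → sum {n} (λ _ → 1#) ≈ n · 1#
  sum-const-1 zero    = refl
  sum-const-1 (suc n) = +-congˡ (sum-const-1 n)

  sum-positive : ∀ {n} (k : Fin n) (f : Fin n → Carrier) →
    (∀ j → 0# ≤ f j) → 0# < f k → 0# < sum f
  sum-positive {suc n} zero f 0≤f 0<f₀ = <-≤-trans 0<f₀ (≤-trans (≈⇒≤ (sym (+-identityʳ (f zero))))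
    (+-mono-≤ (≈⇒≤ refl) (≤-trans (≈⇒≤ (sym (sum-zero {n} (λ _ → 0#) (λ _ → refl))))
      (sum-mono-≤ (λ _ → 0#) (f ∘ suc) (0≤f ∘ suc)))))
  sum-positive (suc k) f 0≤f 0<fₖ = <-≤-trans (sum-positive k (f ∘ suc) (0≤f ∘ suc) 0<fₖ)
    (≤-trans (≈⇒≤ (sym (+-identityˡ (sum (f ∘ suc))))) (+-mono-≤ (0≤f zero) (≈⇒≤ refl)))

  -- A strict inequality at the head or in the tail would make the total strict; `<-tight` turns its
  -- absence into equality.
  sum-extremal : ∀ {n} (f g : Fin n → Carrier) → (∀ j → f j ≤ g j) → sum f ≈ sum g → ∀ j → f j ≈ g j
  sum-extremal {suc n} f g f≤g Σf≈Σg = λ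
    { zero    → <-tight (λ f₀<g₀ → contradiction (<-≤-trans (+-monoˡ-< (sum (f ∘ suc)) f₀<g₀)
                  (+-mono-≤ (≈⇒≤ refl) rest≤)) (≈⇒≤ (sym Σf≈Σg))) (f≤g zero)
    ; (suc j) → sum-extremal (f ∘ suc) (g ∘ suc) (f≤g ∘ suc)
        (<-tight (λ Σf<Σg → contradiction (<-≤-trans (+-monoʳ-< (f zero) Σf<Σg)
          (+-mono-≤ (f≤g zero) (≈⇒≤ refl))) (≈⇒≤ (sym Σf≈Σg))) rest≤) j
    }
    where
    rest≤ : sum (f ∘ suc) ≤ sum (g ∘ suc)
    rest≤ = sum-mono-≤ (f ∘ suc) (g ∘ suc) (f≤g ∘ suc)

-- Planes as fixed spaces of monomial projections

all-or-any : ∀ {n a b} {A : Fin n → Set a} {B : Fin n → Set b} →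
             (∀ j → A j ⊎ B j) → (∀ j → A j) ⊎ ∃[ j ] B j
all-or-any {zero}  f = inj₁ λ ()
all-or-any {suc n} f with f zero | all-or-any (f ∘ suc)
... | inj₂ b | _            = inj₂ (zero , b)
... | inj₁ a | inj₂ (j , b) = inj₂ (suc j , b)
... | inj₁ a | inj₁ as      = inj₁ λ { zero → a ; (suc j) → as j }

module Projections {c ℓ₁ ℓ₂ : Level} (R : RealField c ℓ₁ ℓ₂) where
  open RealField R hiding (zero)
  open Grassmannians R
  open RealFieldProperties R
  open RingProperties ring
  open SemiringSum semiring using (sum-cong-≋; ∑-comm; ∑-distrib-+; *-distribˡ-sum; *-distribʳ-sum)
  open CommutativeSemigroupProperties *-commutativeSemigroup using (x∙yz≈y∙xz; x∙yz≈xz∙y)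
  open ≈-Reasoning setoid

  module _ {m : ℕ} where

    ⊗-$ : ∀ (A B : Matrix m) v x → ((A ⊗ B) $ v) x ≈ (A $ (B $ v)) x
    ⊗-$ A B v x = begin
      sum (λ z → sum (λ y → A x y * B y z) * v z)
        ≈⟨ sum-cong-≋ (λ z → *-distribʳ-sum (v z) (λ y → A x y * B y z)) ⟩
      sum (λ z → sum (λ y → A x y * B y z * v z))
        ≈⟨ ∑-comm (λ z y → A x y * B y z * v z) ⟩
      sum (λ y → sum (λ z → A x y * B y z * v z))
        ≈⟨ sum-cong-≋ (λ y → sum-cong-≋ (λ z → *-assoc (A x y) (B y z) (v z))) ⟩
      sum (λ y → sum (λ z → A x y * (B y z * v z)))
        ≈⟨ sum-cong-≋ (λ y → *-distribˡ-sum (A x y) (λ z → B y z * v z)) ⟨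
      sum (λ y → A x y * sum (λ z → B y z * v z)) ∎

    $-cong : ∀ (A : Matrix m) {v w} → (∀ j → v j ≈ w j) → ∀ x → (A $ v) x ≈ (A $ w) x
    $-cong A v≈w x = sum-cong-≋ (λ y → *-congˡ (v≈w y))

    $-+ : ∀ (A : Matrix m) v w x → (A $ (λ j → v j + w j)) x ≈ (A $ v) x + (A $ w) x
    $-+ A v w x = trans (sum-cong-≋ (λ y → distribˡ (A x y) (v y) (w y)))
                        (∑-distrib-+ (λ y → A x y * v y) (λ y → A x y * w y))

    $-* : ∀ (A : Matrix m) a v x → (A $ (λ j → a * v j)) x ≈ a * (A $ v) x
    $-* A a v x = trans (sum-cong-≋ (λ y → x∙yz≈y∙xz (A x y) a (v y)))
                        (sym (*-distribˡ-sum a (λ y → A x y * v y)))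

    -- For an idempotent matrix this is the range. Stated as an equation it needs no vector as a
    -- witness, so its level is the ℓ₁ demanded by `Grassmannian`.
    Fixed : Matrix m → Pred (Vector Carrier m) ℓ₁
    Fixed A v = ∀ x → (A $ v) x ≈ v x

    Fixed-isSubspace : ∀ A → IsSubspace (Fixed A)
    Fixed-isSubspace A = record
      { respects  = λ v≈w Av≈v x → trans ($-cong A (λ j → sym (v≈w j)) x) (trans (Av≈v x) (v≈w x))
      ; 0-closed  = λ x → sum-zero (λ y → A x y * 0#) (λ y → zeroʳ (A x y))
      ; +-closed  = λ {v} {w} Av≈v Aw≈w x → trans ($-+ A v w x) (+-cong (Av≈v x) (Aw≈w x))
      ; *ₗ-closed = λ a {v} Av≈v x → trans ($-* A a v x) (*-congˡ (Av≈v x))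
      }

    lc-pointwise : ∀ {n} (a : Vector Carrier n) (b : Vector (Vector Carrier m) n) x →
                   linearCombination a b x ≈ sum (λ j → a j * b j x)
    lc-pointwise {zero}  a b x = refl
    lc-pointwise {suc n} a b x = +-congˡ (lc-pointwise (a ∘ suc) (b ∘ suc) x)

    -- The two dichotomies replace decisions between real numbers in the choice of a basis
    -- among the columns.
    record IsMonomialProjection (Π : Matrix m) : Set (c ⊔ ℓ₁ ⊔ ℓ₂) where
      field
        symmetric    : ∀ x y → Π x y ≈ Π y x
        idempotent   : ∀ x y → (Π ⊗ Π) x y ≈ Π x y
        vanishing    : ∀ y → (∀ x → Π x y ≈ 0#) ⊎ 0# < Π y y
        proportional : ∀ x y → Π x y ≈ 0# ⊎ ∃[ s ] (∀ z → Π z y ≈ s * Π z x)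

    module _ {Π : Matrix m} (isMonomial : IsMonomialProjection Π) where
      open IsMonomialProjection isMonomial

      private
        -- Since Π is symmetric and idempotent, `Π x y` is the inner product of the columns x and y.
        -- The fields thus describe nonzero, pairwise orthogonal columns of which every listed
        -- column is a multiple.
        record Selection {l} (y : Fin l → Fin m) : Set (c ⊔ ℓ₁ ⊔ ℓ₂) where
          field
            size       : ℕ
            column     : Fin size → Fin m
            positive   : ∀ a → 0# < Π (column a) (column a)
            orthogonal : ∀ a b → a ≢ b → Π (column a) (column b) ≈ 0#
            covers     : ∀ j → (∀ x → Π x (y j) ≈ 0#) ⊎
                         ∃[ a ] ∃[ s ] (∀ z → Π z (y j) ≈ s * Π z (column a))

        -- A greedy choice. A nonzero column that is a multiple of no chosen one is already
        -- orthogonal to all of them, so nothing has to be orthogonalised.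
        select : ∀ {l} (y : Fin l → Fin m) → Selection y
        select {zero}  y = record
          { size = 0 ; column = λ () ; positive = λ () ; orthogonal = λ () ; covers = λ () }
        select {suc l} y = extend (vanishing (y zero)) (all-or-any (λ a → proportional (column a) (y zero)))
          where
          open Selection (select (y ∘ suc))
          extend : (∀ x → Π x (y zero) ≈ 0#) ⊎ 0# < Π (y zero) (y zero) →
                   (∀ a → Π (column a) (y zero) ≈ 0#) ⊎
                     ∃[ a ] ∃[ s ] (∀ z → Π z (y zero) ≈ s * Π z (column a)) →
                   Selection y
          extend (inj₁ zero-column) _ = record
            { size = size ; column = column ; positive = positive ; orthogonal = orthogonal
            ; covers = λ { zero → inj₁ zero-column ; (suc j) → covers j } }
          extend (inj₂ _) (inj₂ covered) = record
            { size = size ; column = column ; positive = positive ; orthogonal = orthogonal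
            ; covers = λ { zero → inj₂ covered ; (suc j) → covers j } }
          extend (inj₂ 0<Πyy) (inj₁ new) = record
            { size       = suc size
            ; column     = y zero ∷ᶠ column
            ; positive   = λ { zero → 0<Πyy ; (suc a) → positive a }
            ; orthogonal = λ { zero    zero    0≢0 → contradiction ≡.refl 0≢0
                             ; zero    (suc b) _   → trans (symmetric (y zero) (column b)) (new b)
                             ; (suc a) zero    _   → new a
                             ; (suc a) (suc b) a≢b → orthogonal a b (a≢b ∘ ≡.cong suc) }
            ; covers     = λ { zero    → inj₂ (zero , 1# , λ z → sym (*-identityˡ _))
                             ; (suc j) → Sum.map₂ (λ (a , prop) → suc a , prop) (covers j) }
            }

        open Selection (select id)

        norm⁻¹ : Fin size → Carrier
        norm⁻¹ a = recip (Π (column a) (column a)) (positive a)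

        norm-inverseʳ : ∀ a → Π (column a) (column a) * norm⁻¹ a ≈ 1#
        norm-inverseʳ a = recip-inverse _ (positive a)

        norm-inverseˡ : ∀ a → norm⁻¹ a * Π (column a) (column a) ≈ 1#
        norm-inverseˡ a = trans (*-comm _ _) (norm-inverseʳ a)

        -- Π is the sum of the rank-one projections c cᵀ / |c|² over the chosen columns c. Column
        -- `y` is a multiple of a single chosen column, or zero, so at most one term survives.
        expansion : ∀ z y → Π z y ≈ sum (λ a → norm⁻¹ a * (Π z (column a) * Π (column a) y))
        expansion z y with covers y
        ... | inj₁ zero-column = trans (zero-column z) (sym (sum-zero _ (λ a →
                trans (*-congˡ (trans (*-congˡ (zero-column (column a))) (zeroʳ _))) (zeroʳ _))))
        ... | inj₂ (b , s , prop) = sym (begin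
          sum (λ a → norm⁻¹ a * (Π z (column a) * Π (column a) y))
            ≈⟨ sum-single b _ (λ a a≢b → trans (*-congˡ (trans (*-congˡ (trans (prop (column a))
                 (trans (*-congˡ (orthogonal a b a≢b)) (zeroʳ s)))) (zeroʳ _))) (zeroʳ _)) ⟩
          norm⁻¹ b * (Π z (column b) * Π (column b) y)
            ≈⟨ *-congˡ (*-congˡ (prop (column b))) ⟩
          norm⁻¹ b * (Π z (column b) * (s * Π (column b) (column b)))
            ≈⟨ *-congˡ (trans (sym (*-assoc _ s _)) (*-comm _ _)) ⟩
          norm⁻¹ b * (Π (column b) (column b) * (Π z (column b) * s))
            ≈⟨ *-cancel-inverse (norm-inverseˡ b) _ ⟩
          Π z (column b) * s
            ≈⟨ *-comm _ s ⟩
          s * Π z (column b)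
            ≈⟨ prop z ⟨
          Π z y ∎)

        -- By idempotence every rank-one term of `expansion` has trace 1.
        trace-size : trace Π ≈ size · 1#
        trace-size = begin
          sum (λ z → Π z z)
            ≈⟨ sum-cong-≋ (λ z → expansion z z) ⟩
          sum (λ z → sum (λ a → norm⁻¹ a * (Π z (column a) * Π (column a) z)))
            ≈⟨ ∑-comm (λ z a → norm⁻¹ a * (Π z (column a) * Π (column a) z)) ⟩
          sum (λ a → sum (λ z → norm⁻¹ a * (Π z (column a) * Π (column a) z)))
            ≈⟨ sum-cong-≋ (λ a → *-distribˡ-sum (norm⁻¹ a) (λ z → Π z (column a) * Π (column a) z)) ⟨
          sum (λ a → norm⁻¹ a * sum (λ z → Π z (column a) * Π (column a) z))
            ≈⟨ sum-cong-≋ (λ a → *-congˡ (trans (sum-cong-≋ (λ z → *-comm (Π z (column a)) _))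
                 (idempotent (column a) (column a)))) ⟩
          sum (λ a → norm⁻¹ a * Π (column a) (column a))
            ≈⟨ sum-cong-≋ norm-inverseˡ ⟩
          sum {size} (λ _ → 1#)
            ≈⟨ sum-const-1 size ⟩
          size · 1# ∎

        basis : Vector (Vector Carrier m) size
        basis a z = Π z (column a)

        -- Read the relation in the coordinate `column b`: orthogonality leaves the b-th term alone,
        -- with an invertible factor.
        independent : LinearlyIndependent basis
        independent a a∙b≈0 b = *-cancelˡ (norm-inverseˡ b) (begin
          Π (column b) (column b) * a b
            ≈⟨ *-comm _ _ ⟩
          a b * Π (column b) (column b)
            ≈⟨ sum-single b _ (λ j j≢b → trans (*-congˡ (orthogonal b j (j≢b ∘ ≡.sym))) (zeroʳ (a j))) ⟨
          sum (λ j → a j * Π (column b) (column j))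
            ≈⟨ lc-pointwise a basis (column b) ⟨
          linearCombination a basis (column b)
            ≈⟨ a∙b≈0 (column b) ⟩
          0#
            ≈⟨ zeroʳ _ ⟨
          Π (column b) (column b) * 0# ∎)

        spanning : ∀ {v} → Fixed Π v → ∃[ a ] (∀ z → v z ≈ linearCombination a basis z)
        -- As Π v = v, the entry `v (column a)` is the inner product of `v` with the chosen column;
        -- dividing by the squared norm gives its Fourier coefficient.
        spanning {v} Πv≈v = (λ a → norm⁻¹ a * v (column a)) , λ z → begin
          v z
            ≈⟨ Πv≈v z ⟨
          sum (λ y → Π z y * v y)
            ≈⟨ sum-cong-≋ (λ y → trans (*-congʳ (expansion z y))
                 (*-distribʳ-sum (v y) (λ a → norm⁻¹ a * (Π z (column a) * Π (column a) y)))) ⟩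
          sum (λ y → sum (λ a → norm⁻¹ a * (Π z (column a) * Π (column a) y) * v y))
            ≈⟨ ∑-comm (λ y a → norm⁻¹ a * (Π z (column a) * Π (column a) y) * v y) ⟩
          sum (λ a → sum (λ y → norm⁻¹ a * (Π z (column a) * Π (column a) y) * v y))
            ≈⟨ sum-cong-≋ (λ a → trans
                 (sum-cong-≋ (λ y → trans (*-congʳ (sym (*-assoc (norm⁻¹ a) _ _))) (*-assoc _ _ (v y))))
                 (sym (*-distribˡ-sum (norm⁻¹ a * Π z (column a)) (λ y → Π (column a) y * v y)))) ⟩
          sum (λ a → norm⁻¹ a * Π z (column a) * (Π $ v) (column a))
            ≈⟨ sum-cong-≋ (λ a → trans (*-congˡ (Πv≈v (column a)))
                 (trans (*-assoc _ _ _) (x∙yz≈xz∙y (norm⁻¹ a) _ _))) ⟩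
          sum (λ a → norm⁻¹ a * v (column a) * Π z (column a))
            ≈⟨ lc-pointwise (λ a → norm⁻¹ a * v (column a)) basis z ⟨
          linearCombination (λ a → norm⁻¹ a * v (column a)) basis z ∎

        self-adjoint : ∀ v w → ⟨ (Π $ v) , w ⟩ ≈ ⟨ v , (Π $ w) ⟩
        self-adjoint v w = begin
          sum (λ x → sum (λ y → Π x y * v y) * w x)
            ≈⟨ sum-cong-≋ (λ x → *-distribʳ-sum (w x) (λ y → Π x y * v y)) ⟩
          sum (λ x → sum (λ y → Π x y * v y * w x))
            ≈⟨ ∑-comm (λ x y → Π x y * v y * w x) ⟩
          sum (λ y → sum (λ x → Π x y * v y * w x))
            ≈⟨ sum-cong-≋ (λ y → sum-cong-≋ (λ x → trans
                 (*-congʳ (trans (*-comm (Π x y) (v y)) (*-congˡ (symmetric x y))))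
                 (*-assoc (v y) (Π y x) (w x)))) ⟩
          sum (λ y → sum (λ x → v y * (Π y x * w x)))
            ≈⟨ sum-cong-≋ (λ y → *-distribˡ-sum (v y) (λ x → Π y x * w x)) ⟨
          sum (λ y → v y * (Π $ w) y) ∎

      Fixed-isProjection : IsOrthogonalProjection (Fixed Π) Π
      Fixed-isProjection = record
        { range      = λ v x → trans (sym (⊗-$ Π Π v x)) (sum-cong-≋ (λ y → *-congʳ (idempotent x y)))
        ; orthogonal = λ v {w} Πw≈w → begin
            sum (λ j → (v j - (Π $ v) j) * w j)
              -- Subtraction becomes the factor `- 1#`, so that additivity and scaling of sums
              -- suffice.
              ≈⟨ sum-cong-≋ (λ j → trans (distribʳ (w j) (v j) _)
                   (+-congˡ (trans (sym (-‿distribˡ-* _ (w j))) (sym (-1*x≈-x _))))) ⟩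
            sum (λ j → v j * w j + - 1# * ((Π $ v) j * w j))
              ≈⟨ ∑-distrib-+ (λ j → v j * w j) (λ j → - 1# * ((Π $ v) j * w j)) ⟩
            ⟨ v , w ⟩ + sum (λ j → - 1# * ((Π $ v) j * w j))
              ≈⟨ +-congˡ (trans (sym (*-distribˡ-sum (- 1#) (λ j → (Π $ v) j * w j))) (-1*x≈-x _)) ⟩
            ⟨ v , w ⟩ - ⟨ (Π $ v) , w ⟩
              ≈⟨ +-congˡ (-‿cong (trans (self-adjoint v w) (sum-cong-≋ (λ j → *-congˡ (Πw≈w j))))) ⟩
            ⟨ v , w ⟩ - ⟨ v , w ⟩
              ≈⟨ -‿inverseʳ _ ⟩
            0# ∎
        }

      Fixed-dimension : ∀ {n} → trace Π ≈ n · 1# → HasDimension (Fixed Π) n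
      Fixed-dimension {n} trΠ≈n = ≡.subst (HasDimension (Fixed Π))
        (·1-injective size n (trans (sym trace-size) trΠ≈n))
        (basis , record
          { member      = λ a x → idempotent x (column a)
          ; independent = independent
          ; spanning    = spanning
          })

      fixed-plane : ∀ {n} → trace Π ≈ n · 1# → Grassmannian m n
      fixed-plane trΠ≈n = record
        { subspace     = Fixed Π
        ; isSubspace   = Fixed-isSubspace Π
        ; dimension    = Fixed-dimension trΠ≈n
        ; projection   = Π
        ; isProjection = Fixed-isProjection
        }

-- Translations of coordinates and finite search

label-injective : ∀ {n} {j k : Fin (2 ^ℕ n)} → label {n} j ≡ label k → j ≡ k
label-injective {n} {j} {k} eq =
  ≡.trans (≡.sym (index-label {n} j)) (≡.trans (≡.cong index eq) (index-label {n} k))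

anyᵁ? : ∀ {n p} {P : Pred (U n) p} → Decidable P → Dec (∃[ u ] P u)
anyᵁ? {n} {P = P} P? = map′ (λ (j , Pj) → label j , Pj)
  (λ (u , Pu) → index u , ≡.subst P (≡.sym (label-index u)) Pu) (any? (P? ∘ label {n}))

translate : ∀ {n} → U n → Fin (2 ^ℕ n) → Fin (2 ^ℕ n)
translate a x = index (label x ⊕ a)

translate-involutive : ∀ {n} (a : U n) x → translate a (translate a x) ≡ x
translate-involutive {n} a x = ≡.trans (≡.cong (λ u → index (u ⊕ a)) (label-index (label x ⊕ a)))
  (≡.trans (≡.cong index (⊕-cancelʳ (label x) a)) (index-label {n} x))

translate-𝟎 : ∀ {n} (x : Fin (2 ^ℕ n)) → translate {n} 𝟎 x ≡ x
translate-𝟎 {n} x = ≡.trans (≡.cong index (⊕-identityʳ (label {n} x))) (index-label {n} x)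

translate-fixed : ∀ {n} (a : U n) x → translate a x ≡ x → a ≡ 𝟎
translate-fixed {n} a x eq = begin
  a                         ≡⟨ ⊕-cancelˡ (label x) a ⟨
  label x ⊕ (label x ⊕ a)   ≡⟨ ≡.cong (label x ⊕_) (≡.trans (≡.sym (label-index _)) (≡.cong label eq)) ⟩
  label x ⊕ label x         ≡⟨ ⊕-self (label x) ⟩
  𝟎                         ∎
  where open ≡.≡-Reasoning

infix 4 _≟ᵁ_ _≟ᴱ̄_
_≟ᵁ_ : ∀ {n} → DecidableEquality (U n)
_≟ᵁ_ = Vec.≡-dec ℙ._≟_

_≟ᴱ̄_ : ∀ {i} → DecidableEquality (∣Ē∣ i)
_≟ᴱ̄_ = Product.≡-dec _≟ᵁ_ _≟ᵁ_

-- The cocycle of E on a subspace, and its trivialisations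

module _ {i r : ℕ} {P : Pred (∣Ē∣ i) 0ℓ} (C : Coordinates P r) where
  open Coordinates C

  vec-𝟎 : vec 𝟎 ≡ (𝟎 , 𝟎)
  vec-𝟎 = ≡.trans (≡.cong vec (≡.sym (⊕-self 𝟎))) (≡.trans (vec-⊕ 𝟎 𝟎) (≡.cong₂ _,_ (⊕-self _) (⊕-self _)))

  -- X(a)Y(b) X(a′)Y(b′) = (-1)^(b ∙ a′) X(a + a′)Y(b + b′)
  polar : U r → U r → Parity
  polar p q = proj₂ (vec p) ∙ proj₁ (vec q)

  -- `polar p p` is the value of `Q` at `vec p`, so this is total singularity in coordinates: the
  -- cocycle is alternating.
  Isotropic : Set
  Isotropic = ∀ p → polar p p ≡ 0ℙ

  polar-additiveʳ : ∀ p → Additive (polar p)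
  polar-additiveʳ p q q′ = ≡.trans (≡.cong (λ x → proj₂ (vec p) ∙ proj₁ x) (vec-⊕ q q′))
    (∙-distribˡ-⊕ (proj₂ (vec p)) (proj₁ (vec q)) (proj₁ (vec q′)))

  polar-additiveˡ : ∀ q → Additive (λ p → polar p q)
  polar-additiveˡ q p p′ = ≡.trans (≡.cong (λ x → proj₂ x ∙ proj₁ (vec q)) (vec-⊕ p p′))
    (∙-distribʳ-⊕ (proj₁ (vec q)) (proj₂ (vec p)) (proj₂ (vec p′)))

  -- The two orders of a product in E differ by these two signs, so this says that the preimage of
  -- `P` is commutative.
  polar-symmetric : Isotropic → ∀ p q → polar p q ≡ polar q p
  polar-symmetric = alternating⇒symmetric polar polar-additiveʳ polar-additiveˡ

  -- p ↦ (toSign (exponent p) , vec p) is a homomorphism onto the kernel of a character χ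
  -- of the preimage of P with χ(-I) = -1.
  record Lift : Set where
    field
      exponent : U r → Parity
      refines  : IsRefinement polar exponent

    exponent-𝟎 : exponent 𝟎 ≡ 0ℙ
    exponent-𝟎 = begin
      exponent 𝟎                                   ≡⟨ ≡.cong exponent (⊕-self 𝟎) ⟨
      exponent (𝟎 ⊕ 𝟎)                             ≡⟨ refines 𝟎 𝟎 ⟩
      exponent 𝟎 ℙ.+ exponent 𝟎 ℙ.+ polar 𝟎 𝟎      ≡⟨ ≡.cong (ℙ._+ polar 𝟎 𝟎) (ℙ.p+p≡0ℙ (exponent 𝟎)) ⟩
      polar 𝟎 𝟎                                    ≡⟨ additive-𝟎 (polar 𝟎) (polar-additiveʳ 𝟎) ⟩
      0ℙ                                           ∎
      where open ≡.≡-Reasoning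

    exponent+polar : ∀ q p → exponent p ℙ.+ polar q p ≡ exponent q ℙ.+ exponent (q ⊕ p)
    exponent+polar q p = ≡.sym (begin
      exponent q ℙ.+ exponent (q ⊕ p)
        ≡⟨ ≡.cong (exponent q ℙ.+_) (≡.trans (refines q p) (ℙ.+-assoc (exponent q) _ _)) ⟩
      exponent q ℙ.+ (exponent q ℙ.+ (exponent p ℙ.+ polar q p))
        ≡⟨ p+p+q≡q (exponent q) _ ⟩
      exponent p ℙ.+ polar q p ∎)
      where open ≡.≡-Reasoning

  open Lift public

-- Operator traces and eigenprojections

module Eigenplanes {c ℓ₁ ℓ₂ : Level} (R : RealField c ℓ₁ ℓ₂) (i : ℕ) where
  open RealField R hiding (zero)
  open Grassmannians R
  open Clifford R i using (V; ⟦_⟧; _⊙_; ⊙-cong; ⊙-assoc; ⟦⟧-∘)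
  open RealFieldProperties R
  open Projections R
  open RingProperties ring
  open SemiringSum semiring using (sum-cong-≋; ∑-comm; *-distribˡ-sum; *-distribʳ-sum; sum-permute)
  open CommutativeSemigroupProperties *-commutativeSemigroup using (x∙yz≈y∙xz)
  open ≈-Reasoning setoid

  private
    σ : Parity → Sign
    σ = toSign

  ⊙-* : ∀ s x → s ⊙ x ≈ (s ⊙ 1#) * x
  ⊙-* Sign.+ x = sym (*-identityˡ x)
  ⊙-* Sign.- x = sym (-1*x≈-x x)

  ⊙-0 : ∀ s → s ⊙ 0# ≈ 0#
  ⊙-0 s = trans (⊙-* s 0#) (zeroʳ _)

  *-⊙ : ∀ s x y → x * (s ⊙ y) ≈ s ⊙ (x * y)
  *-⊙ s x y = trans (*-congˡ (⊙-* s y)) (trans (x∙yz≈y∙xz x _ y) (sym (⊙-* s (x * y))))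

  ⊙-*ʳ : ∀ s x y → (s ⊙ x) * y ≈ s ⊙ (x * y)
  ⊙-*ʳ s x y = trans (*-congʳ (⊙-* s x)) (trans (*-assoc _ x y) (sym (⊙-* s (x * y))))

  ⊙-sum : ∀ s {n} (f : Fin n → Carrier) → s ⊙ sum f ≈ sum (λ j → s ⊙ f j)
  ⊙-sum s f = trans (⊙-* s (sum f)) (trans (*-distribˡ-sum (s ⊙ 1#) f) (sum-cong-≋ (λ j → sym (⊙-* s (f j)))))

  ⊙-involutive : ∀ s x → s ⊙ s ⊙ x ≈ x
  ⊙-involutive s x = trans (sym (⊙-assoc s s x)) (reflexive (≡.cong (_⊙ x) (Sign.s*s≡+ s)))

  σ-+ : ∀ p q x → σ (p ℙ.+ q) ⊙ x ≈ σ p ⊙ σ q ⊙ x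
  σ-+ p q x = trans (reflexive (≡.cong (_⊙ x) (ℙ.+-homo-* p q))) (⊙-assoc (σ p) (σ q) x)

  ⊙1≤1 : ∀ s → s ⊙ 1# ≤ 1#
  ⊙1≤1 Sign.+ = ≈⇒≤ refl
  ⊙1≤1 Sign.- = ≤-trans (-‿mono-≤ (<-asym 0<1)) (≤-trans (≈⇒≤ -0#≈0#) (<-asym 0<1))

  indicator : ∀ {p} {A : Set p} → Dec A → Carrier
  indicator a? = if does a? then 1# else 0#

  indicator-yes : ∀ {p} {A : Set p} (a? : Dec A) → A → indicator a? ≈ 1#
  indicator-yes (yes _) _ = refl
  indicator-yes (no ¬a) a = contradiction a ¬a

  indicator-no : ∀ {p} {A : Set p} (a? : Dec A) → ¬ A → indicator a? ≈ 0#
  indicator-no (yes a) ¬a = contradiction a ¬a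
  indicator-no (no _)  _  = refl

  indicator-nonneg : ∀ {p} {A : Set p} (a? : Dec A) → 0# ≤ indicator a?
  indicator-nonneg (yes _) = <-asym 0<1
  indicator-nonneg (no _)  = ≈⇒≤ refl

  ∑ᵁ : ∀ {n} → (U n → Carrier) → Carrier
  ∑ᵁ {n} f = sum (λ j → f (label {n} j))

  ∑ᵁ-cong : ∀ {n} {f g : U n → Carrier} → (∀ u → f u ≈ g u) → ∑ᵁ f ≈ ∑ᵁ g
  ∑ᵁ-cong {n} f≈g = sum-cong-≋ (λ j → f≈g (label {n} j))

  ∑ᵁ-mono-≤ : ∀ {n} {f g : U n → Carrier} → (∀ u → f u ≤ g u) → ∑ᵁ f ≤ ∑ᵁ g
  ∑ᵁ-mono-≤ {n} f≤g = sum-mono-≤ _ _ (λ j → f≤g (label {n} j))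

  ∑ᵁ-zero : ∀ {n} {f : U n → Carrier} → (∀ u → f u ≈ 0#) → ∑ᵁ f ≈ 0#
  ∑ᵁ-zero {n} f≈0 = sum-zero _ (λ j → f≈0 (label {n} j))

  ∑ᵁ-single : ∀ {n} (w : U n) (f : U n → Carrier) → (∀ u → u ≢ w → f u ≈ 0#) → ∑ᵁ f ≈ f w
  ∑ᵁ-single {n} w f f≈0 = trans
    (sum-single (index w) _ (λ j j≢ → f≈0 (label j) (λ eq → j≢ (≡.trans (≡.sym (index-label {n} j)) (≡.cong index eq)))))
    (reflexive (≡.cong f (label-index w)))

  ∑ᵁ-1 : ∀ n → ∑ᵁ {n} (λ _ → 1#) ≈ 2# ^ n
  ∑ᵁ-1 n = trans (sum-const-1 (2 ^ℕ n)) (2^ℕ·1 n)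

  *-distribˡ-∑ᵁ : ∀ {n} a (f : U n → Carrier) → a * ∑ᵁ f ≈ ∑ᵁ (λ u → a * f u)
  *-distribˡ-∑ᵁ {n} a f = *-distribˡ-sum a (λ j → f (label {n} j))

  ⊙-∑ᵁ : ∀ s {n} (f : U n → Carrier) → s ⊙ ∑ᵁ f ≈ ∑ᵁ (λ u → s ⊙ f u)
  ⊙-∑ᵁ s {n} f = ⊙-sum s (λ j → f (label {n} j))

  ∑ᵁ-extremal : ∀ {n} (f : U n → Carrier) → (∀ u → f u ≤ 1#) → ∑ᵁ f ≈ 2# ^ n → ∀ u → f u ≈ 1#
  ∑ᵁ-extremal {n} f f≤1 Σf≈ u = trans (reflexive (≡.cong f (≡.sym (label-index u))))
    (sum-extremal _ (λ _ → 1#) (λ j → f≤1 (label {n} j)) (trans Σf≈ (sym (∑ᵁ-1 n))) (index u))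

  ∑ᵁ-translate : ∀ {n} (a : U n) (f : U n → Carrier) → ∑ᵁ (λ u → f (u ⊕ a)) ≈ ∑ᵁ f
  ∑ᵁ-translate {n} a f = sym (trans
    (sum-permute (λ j → f (label {n} j)) (Perm.permutation (translate a) (translate a)
      (translate-involutive a) (translate-involutive a)))
    (sum-cong-≋ (λ j → reflexive (≡.cong f (label-index (label {n} j ⊕ a))))))

  -- Translation by a vector `a` with t ∙ a = 1 permutes the terms and reverses every sign.
  character-sum : ∀ {n} {t : U n} → t ≢ 𝟎 → ∑ᵁ (λ u → σ (t ∙ u) ⊙ 1#) ≈ 0#
  character-sum {n} {t} t≢𝟎 with separating-vector t t≢𝟎
  ... | a , t∙a≡1 = x≈-x⇒x≈0 (begin
    ∑ᵁ (λ u → σ (t ∙ u) ⊙ 1#)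
      ≈⟨ ∑ᵁ-translate a (λ u → σ (t ∙ u) ⊙ 1#) ⟨
    ∑ᵁ (λ u → σ (t ∙ (u ⊕ a)) ⊙ 1#)
      ≈⟨ ∑ᵁ-cong (λ u → trans (reflexive (≡.cong (λ p → σ p ⊙ 1#) (≡.trans (∙-distribˡ-⊕ t u a)
           (≡.trans (ℙ.+-comm (t ∙ u) _) (≡.cong (ℙ._+ t ∙ u) t∙a≡1))))) (σ-+ 1ℙ (t ∙ u) 1#)) ⟩
    ∑ᵁ (λ u → Sign.- ⊙ σ (t ∙ u) ⊙ 1#)
      ≈⟨ ⊙-∑ᵁ Sign.- (λ u → σ (t ∙ u) ⊙ 1#) ⟨
    - ∑ᵁ (λ u → σ (t ∙ u) ⊙ 1#) ∎)

  -- The basis vector `e (label y)`, indexed by a coordinate so that it can serve as a column index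
  -- of matrices.
  δ : Fin (2 ^ℕ i) → V
  δ y x = indicator (y ≟ x)

  ⟦⟧-cong : ∀ g {v w} → (∀ x → v x ≈ w x) → ∀ x → ⟦ g ⟧ v x ≈ ⟦ g ⟧ w x
  ⟦⟧-cong (s , a , b) v≈w x = ⊙-cong s (⊙-cong (σ (b ∙ label {i} (translate a x))) (v≈w _))

  ⟦⟧-⊙ : ∀ g s v x → ⟦ g ⟧ (λ z → s ⊙ v z) x ≈ s ⊙ ⟦ g ⟧ v x
  ⟦⟧-⊙ (s′ , a , b) s v x = trans
    (⊙-cong s′ (swap (σ (b ∙ label {i} (translate a x))) s _)) (swap s′ s _)
    where
    swap : ∀ s t x → s ⊙ t ⊙ x ≈ t ⊙ s ⊙ x
    swap s t x = trans (sym (⊙-assoc s t x))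
      (trans (reflexive (≡.cong (_⊙ x) (Sign.*-comm s t))) (⊙-assoc t s x))

  ⟦⟧-* : ∀ g a v x → ⟦ g ⟧ (λ z → a * v z) x ≈ a * ⟦ g ⟧ v x
  ⟦⟧-* (s , u , b) a v x = sym (trans (*-⊙ s a _) (⊙-cong s (*-⊙ (σ (b ∙ label {i} (translate u x))) a _)))

  ⟦⟧-∑ᵁ : ∀ g {n} (f : U n → V) x → ⟦ g ⟧ (λ z → ∑ᵁ (λ p → f p z)) x ≈ ∑ᵁ (λ p → ⟦ g ⟧ (f p) x)
  ⟦⟧-∑ᵁ (s , a , b) {n} f x = trans
    (⊙-cong s (⊙-∑ᵁ s′ (λ p → f p (translate a x))))
    (⊙-∑ᵁ s (λ p → s′ ⊙ f p (translate a x)))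
    where s′ = σ (b ∙ label {i} (translate a x))

  ⟦⟧-columns : ∀ g v x → sum (λ y → ⟦ g ⟧ (δ y) x * v y) ≈ ⟦ g ⟧ v x
  ⟦⟧-columns (s , a , b) v x = begin
    sum (λ y → (s ⊙ s′ ⊙ δ y z) * v y)
      ≈⟨ sum-cong-≋ (λ y → trans (⊙-*ʳ s _ (v y)) (⊙-cong s (⊙-*ʳ s′ _ (v y)))) ⟩
    sum (λ y → s ⊙ s′ ⊙ (δ y z * v y))
      ≈⟨ trans (sym (⊙-sum s (λ y → s′ ⊙ (δ y z * v y)))) (⊙-cong s (sym (⊙-sum s′ (λ y → δ y z * v y)))) ⟩
    s ⊙ s′ ⊙ sum (λ y → δ y z * v y)
      ≈⟨ ⊙-cong s (⊙-cong s′ (trans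
           (sum-single z _ (λ y y≢z → trans (*-congʳ (indicator-no (y ≟ z) y≢z)) (zeroˡ (v y))))
           (trans (*-congʳ (indicator-yes (z ≟ z) ≡.refl)) (*-identityˡ (v z))))) ⟩
    s ⊙ s′ ⊙ v z ∎
    where
    z = translate a x
    s′ = σ (b ∙ label {i} z)

  ⟦⟧-δ : ∀ a b y x → ⟦ Sign.+ , a , b ⟧ (δ y) x ≈ σ (b ∙ label {i} y) ⊙ δ (translate a y) x
  ⟦⟧-δ a b y x with y ≟ translate a x
  ... | yes ≡.refl = ⊙-cong (σ (b ∙ label {i} y))
    (sym (indicator-yes (translate a y ≟ x) (translate-involutive a x)))
  ... | no y≢ = trans (⊙-0 (σ (b ∙ label {i} (translate a x)))) (sym (trans
    (⊙-cong (σ (b ∙ label {i} y)) (indicator-no (translate a y ≟ x)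
      λ { ≡.refl → y≢ (≡.sym (translate-involutive a y)) }))
    (⊙-0 (σ (b ∙ label {i} y)))))

  operator-trace : E i → Carrier
  operator-trace g = sum (λ x → ⟦ g ⟧ (δ x) x)

  operator-trace-I : operator-trace I ≈ 2# ^ i
  operator-trace-I = trans (sum-cong-≋ diagonal) (∑ᵁ-1 i)
    where
    diagonal : ∀ x → ⟦ I ⟧ (δ x) x ≈ 1#
    diagonal x = trans (⟦⟧-δ 𝟎 𝟎 x x) (trans
      (reflexive (≡.cong (λ p → σ p ⊙ δ (translate {i} 𝟎 x) x)
        (≡.trans (∙-comm 𝟎 (label {i} x)) (∙-zeroʳ (label {i} x)))))
      (indicator-yes (translate {i} 𝟎 x ≟ x) (translate-𝟎 {i} x)))

  -- For a ≠ 0 the translation by `a` has no fixed point, so the diagonal is zero. For a = 0 the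
  -- diagonal consists of the values of a nontrivial character.
  operator-trace-0 : ∀ {x} → x ≢ (𝟎 , 𝟎) → operator-trace (Sign.+ , x) ≈ 0#
  operator-trace-0 {a , b} x≢𝟎 with a ≟ᵁ 𝟎
  ... | no a≢𝟎 = sum-zero _ (λ y → trans (⟦⟧-δ a b y y) (trans
    (⊙-cong (σ (b ∙ label {i} y)) (indicator-no (translate a y ≟ y) (a≢𝟎 ∘ translate-fixed a y)))
    (⊙-0 (σ (b ∙ label {i} y)))))
  ... | yes ≡.refl = trans
    (sum-cong-≋ (λ y → trans (⟦⟧-δ 𝟎 b y y)
      (⊙-cong (σ (b ∙ label {i} y)) (indicator-yes (translate {i} 𝟎 y ≟ y) (translate-𝟎 {i} y)))))
    (character-sum (x≢𝟎 ∘ ≡.cong (𝟎 ,_)))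

  module _ {r : ℕ} {P : Pred (∣Ē∣ i) 0ℓ} (C : Coordinates P r) (isotropic : Isotropic C) where
    open Coordinates C

    ⟦vec⟧-∘ : ∀ p q v x → ⟦ Sign.+ , vec p ⟧ (⟦ Sign.+ , vec q ⟧ v) x ≈
                          σ (polar C p q) ⊙ ⟦ Sign.+ , vec (p ⊕ q) ⟧ v x
    ⟦vec⟧-∘ p q v x = trans (sym (⟦⟧-∘ (Sign.+ , vec p) (Sign.+ , vec q) v x))
      (reflexive (≡.cong (λ y → ⟦ σ (polar C p q) , y ⟧ v x) (≡.sym (vec-⊕ p q))))

    ⟦vec⟧-comm : ∀ p q v x → ⟦ Sign.+ , vec p ⟧ (⟦ Sign.+ , vec q ⟧ v) x ≈
                             ⟦ Sign.+ , vec q ⟧ (⟦ Sign.+ , vec p ⟧ v) x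
    ⟦vec⟧-comm p q v x = trans (⟦vec⟧-∘ p q v x) (trans
      (reflexive (≡.cong₂ (λ ς w → σ ς ⊙ ⟦ Sign.+ , vec w ⟧ v x) (polar-symmetric C isotropic p q) (⊕-comm p q)))
      (sym (⟦vec⟧-∘ q p v x)))

    module _ (L : Lift C) where

      private
        ε : U r → Parity
        ε = exponent L

      -- Kept as an operator because E acts on functions; its matrix is read off on the vectors
      -- `δ y`.
      average : V → V
      average v x = ½ ^ r * ∑ᵁ (λ p → σ (ε p) ⊙ ⟦ Sign.+ , vec p ⟧ v x)

      eigenprojection : Matrix (2 ^ℕ i)
      eigenprojection x y = average (δ y) x

      Eigenvector : Pred V ℓ₁
      Eigenvector v = ∀ p x → ⟦ Sign.+ , vec p ⟧ v x ≈ σ (ε p) ⊙ v x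

      average-cong : ∀ {v w} → (∀ x → v x ≈ w x) → ∀ x → average v x ≈ average w x
      average-cong v≈w x = *-congˡ (∑ᵁ-cong (λ p → ⊙-cong (σ (ε p)) (⟦⟧-cong (Sign.+ , vec p) v≈w x)))

      eigenprojection-$ : ∀ v x → (eigenprojection $ v) x ≈ average v x
      eigenprojection-$ v x = begin
        sum (λ y → ½ ^ r * ∑ᵁ (λ p → M p y) * v y)
          ≈⟨ sum-cong-≋ (λ y → trans (*-assoc _ _ (v y)) (*-congˡ (*-distribʳ-sum (v y) (λ j → M (label {r} j) y)))) ⟩
        sum (λ y → ½ ^ r * ∑ᵁ (λ p → M p y * v y))
          ≈⟨ *-distribˡ-sum (½ ^ r) (λ y → ∑ᵁ (λ p → M p y * v y)) ⟨
        ½ ^ r * sum (λ y → ∑ᵁ (λ p → M p y * v y))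
          ≈⟨ *-congˡ (∑-comm (λ y j → M (label {r} j) y * v y)) ⟩
        ½ ^ r * ∑ᵁ (λ p → sum (λ y → M p y * v y))
          ≈⟨ *-congˡ (∑ᵁ-cong (λ p → trans
               (sum-cong-≋ (λ y → ⊙-*ʳ (σ (ε p)) (⟦ Sign.+ , vec p ⟧ (δ y) x) (v y)))
               (trans (sym (⊙-sum (σ (ε p)) (λ y → ⟦ Sign.+ , vec p ⟧ (δ y) x * v y))) (⊙-cong (σ (ε p)) (⟦⟧-columns (Sign.+ , vec p) v x))))) ⟩
        average v x ∎
        where
        M : U r → Fin (2 ^ℕ i) → Carrier
        M p y = σ (ε p) ⊙ ⟦ Sign.+ , vec p ⟧ (δ y) x

      ⟦⟧-average : ∀ g v x → ⟦ g ⟧ (average v) x ≈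
        ½ ^ r * ∑ᵁ (λ p → σ (ε p) ⊙ ⟦ g ⟧ (⟦ Sign.+ , vec p ⟧ v) x)
      ⟦⟧-average g v x = trans
        (⟦⟧-* g (½ ^ r) (λ z → ∑ᵁ (λ p → σ (ε p) ⊙ ⟦ Sign.+ , vec p ⟧ v z)) x)
        (*-congˡ (trans
          (⟦⟧-∑ᵁ g (λ p z → σ (ε p) ⊙ ⟦ Sign.+ , vec p ⟧ v z) x)
          (∑ᵁ-cong (λ p → ⟦⟧-⊙ g (σ (ε p)) (⟦ Sign.+ , vec p ⟧ v) x))))

      -- Acting with `vec q` moves the summand of `p` to that of `p ⊕ q`; by `exponent+polar` the
      -- sign left over is σ (ε q) for every `p`.
      average-eigenvector : ∀ v → Eigenvector (average v)
      average-eigenvector v q x = begin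
        ⟦ Sign.+ , vec q ⟧ (average v) x
          ≈⟨ ⟦⟧-average (Sign.+ , vec q) v x ⟩
        ½ ^ r * ∑ᵁ (λ p → σ (ε p) ⊙ ⟦ Sign.+ , vec q ⟧ (⟦ Sign.+ , vec p ⟧ v) x)
          ≈⟨ *-congˡ (∑ᵁ-cong term) ⟩
        ½ ^ r * ∑ᵁ (λ p → σ (ε q) ⊙ f (p ⊕ q))
          ≈⟨ *-congˡ (trans (sym (⊙-∑ᵁ (σ (ε q)) (λ p → f (p ⊕ q)))) (⊙-cong (σ (ε q)) (∑ᵁ-translate q f))) ⟩
        ½ ^ r * (σ (ε q) ⊙ ∑ᵁ f)
          ≈⟨ *-⊙ (σ (ε q)) _ _ ⟩
        σ (ε q) ⊙ average v x ∎
        where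
        f : U r → Carrier
        f p = σ (ε p) ⊙ ⟦ Sign.+ , vec p ⟧ v x
        term : ∀ p → σ (ε p) ⊙ ⟦ Sign.+ , vec q ⟧ (⟦ Sign.+ , vec p ⟧ v) x ≈ σ (ε q) ⊙ f (p ⊕ q)
        term p = begin
          σ (ε p) ⊙ ⟦ Sign.+ , vec q ⟧ (⟦ Sign.+ , vec p ⟧ v) x
            ≈⟨ ⊙-cong (σ (ε p)) (⟦vec⟧-∘ q p v x) ⟩
          σ (ε p) ⊙ σ (polar C q p) ⊙ ⟦ Sign.+ , vec (q ⊕ p) ⟧ v x
            ≈⟨ σ-+ (ε p) (polar C q p) _ ⟨
          σ (ε p ℙ.+ polar C q p) ⊙ ⟦ Sign.+ , vec (q ⊕ p) ⟧ v x
            ≡⟨ ≡.cong (λ ς → σ ς ⊙ ⟦ Sign.+ , vec (q ⊕ p) ⟧ v x) (exponent+polar L q p) ⟩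
          σ (ε q ℙ.+ ε (q ⊕ p)) ⊙ ⟦ Sign.+ , vec (q ⊕ p) ⟧ v x
            ≈⟨ σ-+ (ε q) (ε (q ⊕ p)) _ ⟩
          σ (ε q) ⊙ f (q ⊕ p)
            ≡⟨ ≡.cong (λ w → σ (ε q) ⊙ f w) (⊕-comm q p) ⟩
          σ (ε q) ⊙ f (p ⊕ q) ∎

      -- The operators commute, so `average` absorbs them on the right with the same eigenvalue as
      -- on the left.
      average-⟦vec⟧ : ∀ q v x → average (⟦ Sign.+ , vec q ⟧ v) x ≈ σ (ε q) ⊙ average v x
      average-⟦vec⟧ q v x = begin
        average (⟦ Sign.+ , vec q ⟧ v) x
          ≈⟨ *-congˡ (∑ᵁ-cong (λ p → ⊙-cong (σ (ε p)) (⟦vec⟧-comm p q v x))) ⟩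
        ½ ^ r * ∑ᵁ (λ p → σ (ε p) ⊙ ⟦ Sign.+ , vec q ⟧ (⟦ Sign.+ , vec p ⟧ v) x)
          ≈⟨ ⟦⟧-average (Sign.+ , vec q) v x ⟨
        ⟦ Sign.+ , vec q ⟧ (average v) x
          ≈⟨ average-eigenvector v q x ⟩
        σ (ε q) ⊙ average v x ∎

      average-fixes : ∀ {v} → Eigenvector v → ∀ x → average v x ≈ v x
      average-fixes {v} eigen x = begin
        ½ ^ r * ∑ᵁ (λ p → σ (ε p) ⊙ ⟦ Sign.+ , vec p ⟧ v x)
          ≈⟨ *-congˡ (∑ᵁ-cong (λ p → trans (⊙-cong (σ (ε p)) (eigen p x)) (trans (⊙-involutive (σ (ε p)) (v x))
               (sym (*-identityˡ (v x)))))) ⟩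
        ½ ^ r * ∑ᵁ {r} (λ _ → 1# * v x)
          ≈⟨ *-congˡ (*-distribʳ-sum {2 ^ℕ r} (v x) (λ _ → 1#)) ⟨
        ½ ^ r * (∑ᵁ {r} (λ _ → 1#) * v x)
          ≈⟨ *-congˡ (*-congʳ (∑ᵁ-1 r)) ⟩
        ½ ^ r * (2# ^ r * v x)
          ≈⟨ *-cancel-inverse (½^*2^ r) (v x) ⟩
        v x ∎

      Fixed⇒Eigenvector : ∀ {v} → Fixed eigenprojection v → Eigenvector v
      Fixed⇒Eigenvector {v} fixed p x = begin
        ⟦ Sign.+ , vec p ⟧ v x            ≈⟨ ⟦⟧-cong (Sign.+ , vec p) v≈ x ⟩
        ⟦ Sign.+ , vec p ⟧ (average v) x  ≈⟨ average-eigenvector v p x ⟩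
        σ (ε p) ⊙ average v x             ≈⟨ ⊙-cong (σ (ε p)) (v≈ x) ⟨
        σ (ε p) ⊙ v x                     ∎
        where
        v≈ : ∀ z → v z ≈ average v z
        v≈ z = trans (sym (fixed z)) (eigenprojection-$ v z)

      Eigenvector⇒Fixed : ∀ {v} → Eigenvector v → Fixed eigenprojection v
      Eigenvector⇒Fixed {v} eigen x = trans (eigenprojection-$ v x) (average-fixes eigen x)

      -- X(a)Y(b) takes `δ y` to ± `δ (translate a y)`, and the average absorbs X(a)Y(b). Columns in
      -- one orbit of these translations therefore agree up to sign.
      column-translate : ∀ p y z → average (δ (translate (proj₁ (vec p)) y)) z ≈
                                   σ (ε p ℙ.+ proj₂ (vec p) ∙ label {i} y) ⊙ average (δ y) z
      column-translate p y z = begin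
        average (δ (translate a y)) z
          ≈⟨ average-cong (λ x → trans (sym (⊙-involutive s _))
               (trans (⊙-cong s (sym (⟦⟧-δ a b y x))) (sym (⟦⟧-⊙ (Sign.+ , vec p) s (δ y) x)))) z ⟩
        average (⟦ Sign.+ , vec p ⟧ (λ x → s ⊙ δ y x)) z
          ≈⟨ average-⟦vec⟧ p (λ x → s ⊙ δ y x) z ⟩
        σ (ε p) ⊙ average (λ x → s ⊙ δ y x) z
          ≈⟨ ⊙-cong (σ (ε p)) (average-⊙ s (δ y) z) ⟩
        σ (ε p) ⊙ s ⊙ average (δ y) z
          ≈⟨ σ-+ (ε p) (b ∙ label {i} y) _ ⟨
        σ (ε p ℙ.+ b ∙ label {i} y) ⊙ average (δ y) z ∎
        where
        a = proj₁ (vec p)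
        b = proj₂ (vec p)
        s = σ (b ∙ label {i} y)
        average-⊙ : ∀ s v x → average (λ z → s ⊙ v z) x ≈ s ⊙ average v x
        average-⊙ s v x = begin
          average (λ z → s ⊙ v z) x
            ≈⟨ eigenprojection-$ _ x ⟨
          (eigenprojection $ (λ z → s ⊙ v z)) x
            ≈⟨ trans (sum-cong-≋ (λ y → *-⊙ s (eigenprojection x y) (v y)))
                 (sym (⊙-sum s (λ y → eigenprojection x y * v y))) ⟩
          s ⊙ (eigenprojection $ v) x
            ≈⟨ ⊙-cong s (eigenprojection-$ v x) ⟩
          s ⊙ average v x ∎

      private
        entry : ∀ x y p → σ (ε p) ⊙ ⟦ Sign.+ , vec p ⟧ (δ y) x ≈
          σ (ε p ℙ.+ proj₂ (vec p) ∙ label {i} y) ⊙ δ (translate (proj₁ (vec p)) y) x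
        entry x y p = trans (⊙-cong (σ (ε p)) (⟦⟧-δ (proj₁ (vec p)) (proj₂ (vec p)) y x))
          (sym (σ-+ (ε p) (proj₂ (vec p) ∙ label {i} y) _))

        entry-0 : ∀ x y p → translate (proj₁ (vec p)) y ≢ x → σ (ε p) ⊙ ⟦ Sign.+ , vec p ⟧ (δ y) x ≈ 0#
        entry-0 x y p ≢x = trans (entry x y p) (trans
          (⊙-cong (σ (ε p ℙ.+ proj₂ (vec p) ∙ label {i} y)) (indicator-no (translate (proj₁ (vec p)) y ≟ x) ≢x))
          (⊙-0 (σ (ε p ℙ.+ proj₂ (vec p) ∙ label {i} y))))

        entry-± : ∀ x y p → translate (proj₁ (vec p)) y ≡ x →
          σ (ε p) ⊙ ⟦ Sign.+ , vec p ⟧ (δ y) x ≈ σ (ε p ℙ.+ proj₂ (vec p) ∙ label {i} y) ⊙ 1#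
        entry-± x y p ≡x = trans (entry x y p)
          (⊙-cong (σ (ε p ℙ.+ proj₂ (vec p) ∙ label {i} y)) (indicator-yes (translate (proj₁ (vec p)) y ≟ x) ≡x))

      -- Every summand is a symmetric matrix: its entries from y to y + a and back carry the signs
      -- of b ∙ y and b ∙ (y + a), which agree since b ∙ a = 0.
      eigenprojection-symmetric : ∀ x y → eigenprojection x y ≈ eigenprojection y x
      eigenprojection-symmetric x y = *-congˡ (∑ᵁ-cong term)
        where
        term : ∀ p → σ (ε p) ⊙ ⟦ Sign.+ , vec p ⟧ (δ y) x ≈ σ (ε p) ⊙ ⟦ Sign.+ , vec p ⟧ (δ x) y
        term p with translate (proj₁ (vec p)) y ≟ x
        ... | no ≢x = trans (entry-0 x y p ≢x) (sym (entry-0 y x p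
                        (λ eq → ≢x (≡.trans (≡.cong (translate a) (≡.sym eq)) (translate-involutive a x)))))
          where a = proj₁ (vec p)
        ... | yes ≡.refl = trans (entry-± x y p ≡.refl) (trans
          (reflexive (≡.cong (λ ς → σ (ε p ℙ.+ ς) ⊙ 1#) (≡.sym (≡.trans
            (≡.cong (b ∙_) (label-index (label {i} y ⊕ a))) (≡.trans
            (∙-distribˡ-⊕ b (label {i} y) a) (≡.trans
            (≡.cong (b ∙ label {i} y ℙ.+_) (isotropic p))
            (ℙ.+-identityʳ _)))))))
          (sym (entry-± y x p (translate-involutive a y))))
          where
          a = proj₁ (vec p)
          b = proj₂ (vec p)

      eigenprojection-idempotent : ∀ x y → (eigenprojection ⊗ eigenprojection) x y ≈ eigenprojection x y
      eigenprojection-idempotent x y = trans (eigenprojection-$ (average (δ y)) x)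
        (average-fixes (average-eigenvector (δ y)) x)

      -- If some `p` fixes `y` with sign -1, the column is its own negative. Otherwise no diagonal
      -- summand is negative, and that of p = 𝟎 is 1.
      eigenprojection-vanishing : ∀ y → (∀ x → eigenprojection x y ≈ 0#) ⊎ 0# < eigenprojection y y
      eigenprojection-vanishing y
        with anyᵁ? (λ p → (translate (proj₁ (vec p)) y ≟ y) ×-dec (ε p ℙ.+ proj₂ (vec p) ∙ label {i} y ℙ.≟ 1ℙ))
      ... | yes (p , ≡y , sign≡-) = inj₁ λ x → x≈-x⇒x≈0 (trans
              (reflexive (≡.cong (λ z → average (δ z) x) (≡.sym ≡y))) (trans (column-translate p y x)
              (reflexive (≡.cong (λ ς → σ ς ⊙ average (δ y) x) sign≡-))))
      ... | no none = inj₂ (*-pos (0<½^ r) (sum-positive (index {r} 𝟎) _ (λ j → nonneg (label {r} j))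
              (≡.subst (λ p → 0# < σ (ε p) ⊙ ⟦ Sign.+ , vec p ⟧ (δ y) y) (≡.sym (label-index {r} 𝟎))
                (<-respʳ-≈ (sym (term≈1 𝟎 (≡.trans (≡.cong (λ x → translate (proj₁ x) y) (vec-𝟎 C)) (translate-𝟎 {i} y))))
                  0<1))))
        where
        term≈1 : ∀ p → translate (proj₁ (vec p)) y ≡ y → σ (ε p) ⊙ ⟦ Sign.+ , vec p ⟧ (δ y) y ≈ 1#
        term≈1 p ≡y = trans (entry-± y y p ≡y) (positive _ (λ eq → none (p , ≡y , eq)))
          where
          positive : ∀ ς → ς ≢ 1ℙ → σ ς ⊙ 1# ≈ 1#
          positive 0ℙ _   = refl
          positive 1ℙ ς≢1 = contradiction ≡.refl ς≢1
        nonneg : ∀ p → 0# ≤ σ (ε p) ⊙ ⟦ Sign.+ , vec p ⟧ (δ y) y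
        nonneg p with translate (proj₁ (vec p)) y ≟ y
        ... | yes ≡y = ≤-trans (<-asym 0<1) (≈⇒≤ (sym (term≈1 p ≡y)))
        ... | no ≢y  = ≈⇒≤ (sym (entry-0 y y p ≢y))

      -- If a translation takes `x` to `y`, the columns agree up to sign; if none does, every
      -- summand of the entry is zero.
      eigenprojection-proportional : ∀ x y → eigenprojection x y ≈ 0# ⊎
        ∃[ s ] (∀ z → eigenprojection z y ≈ s * eigenprojection z x)
      eigenprojection-proportional x y with anyᵁ? (λ p → translate (proj₁ (vec p)) x ≟ y)
      ... | yes (p , ≡.refl) = inj₂ (σ ς ⊙ 1# , λ z → trans (column-translate p x z) (⊙-* (σ ς) _))
        where ς = ε p ℙ.+ proj₂ (vec p) ∙ label {i} x
      ... | no none = inj₁ (trans (eigenprojection-symmetric x y) (trans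
        (*-congˡ (∑ᵁ-zero (λ p → entry-0 y x p (λ eq → none (p , eq))))) (zeroʳ (½ ^ r))))

      eigenprojection-isMonomial : IsMonomialProjection eigenprojection
      eigenprojection-isMonomial = record
        { symmetric    = eigenprojection-symmetric
        ; idempotent   = eigenprojection-idempotent
        ; vanishing    = eigenprojection-vanishing
        ; proportional = eigenprojection-proportional
        }

      trace-eigenprojection : trace eigenprojection ≈ ½ ^ r * 2# ^ i
      trace-eigenprojection = begin
        sum (λ x → ½ ^ r * ∑ᵁ (λ p → f p x))
          ≈⟨ *-distribˡ-sum (½ ^ r) (λ x → ∑ᵁ (λ p → f p x)) ⟨
        ½ ^ r * sum (λ x → ∑ᵁ (λ p → f p x))
          ≈⟨ *-congˡ (∑-comm (λ x j → f (label {r} j) x)) ⟩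
        ½ ^ r * ∑ᵁ (λ p → sum (f p))
          ≈⟨ *-congˡ (∑ᵁ-cong (λ p → sym (⊙-sum (σ (ε p)) (λ x → ⟦ Sign.+ , vec p ⟧ (δ x) x)))) ⟩
        ½ ^ r * ∑ᵁ (λ p → σ (ε p) ⊙ operator-trace (Sign.+ , vec p))
          ≈⟨ *-congˡ (∑ᵁ-single 𝟎 _ (λ p p≢𝟎 → trans
               (⊙-cong (σ (ε p)) (operator-trace-0 (λ eq → p≢𝟎 (injective (≡.trans eq (≡.sym (vec-𝟎 C)))))))
               (⊙-0 (σ (ε p))))) ⟩
        ½ ^ r * (σ (ε 𝟎) ⊙ operator-trace (Sign.+ , vec 𝟎))
          ≡⟨ ≡.cong₂ (λ ς x → ½ ^ r * (σ ς ⊙ operator-trace (Sign.+ , x))) (exponent-𝟎 L) (vec-𝟎 C) ⟩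
        ½ ^ r * operator-trace I
          ≈⟨ *-congˡ operator-trace-I ⟩
        ½ ^ r * 2# ^ i ∎
        where
        f : U r → Fin (2 ^ℕ i) → Carrier
        f p x = σ (ε p) ⊙ ⟦ Sign.+ , vec p ⟧ (δ x) x

-- Characters of the preimage and lifts

module _ {i r : ℕ} {P : Pred (∣Ē∣ i) 0ℓ} (C : Coordinates P r) where
  open Coordinates C

  singular⇒isotropic : TotallySingular P → Isotropic C
  singular⇒isotropic singular p = ≡.trans (∙-comm (proj₂ (vec p)) (proj₁ (vec p)))
    (≡.trans (≡.sym (Q-formula (proj₁ (vec p)) (proj₂ (vec p)))) (singular (vec p) (member p)))

  module _ (isotropic : Isotropic C) where
    private
      refinement : Σ (U r → Parity) (IsRefinement (polar C))
      refinement = quadratic-refinement (polar C) (polar-additiveʳ C) (polar-additiveˡ C) isotropic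
      η : U r → Parity
      η = proj₁ refinement

    -- Lifts form a torsor under linear forms; the base point η and the dot products index them by
    -- `U r`.
    lift : U r → Lift C
    lift t = record
      { exponent = λ p → η p ℙ.+ t ∙ p
      ; refines  = λ p q → begin
          η (p ⊕ q) ℙ.+ t ∙ (p ⊕ q)
            ≡⟨ ≡.cong₂ ℙ._+_ (proj₂ refinement p q) (∙-distribˡ-⊕ t p q) ⟩
          η p ℙ.+ η q ℙ.+ polar C p q ℙ.+ (t ∙ p ℙ.+ t ∙ q)
            ≡⟨ xy∙z≈xz∙y (η p ℙ.+ η q) (polar C p q) _ ⟩
          η p ℙ.+ η q ℙ.+ (t ∙ p ℙ.+ t ∙ q) ℙ.+ polar C p q
            ≡⟨ ≡.cong (ℙ._+ polar C p q) (interchange (η p) (η q) (t ∙ p) (t ∙ q)) ⟩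
          η p ℙ.+ t ∙ p ℙ.+ (η q ℙ.+ t ∙ q) ℙ.+ polar C p q ∎
      }
      where
      open CommutativeSemigroupProperties ℙ.+-commutativeSemigroup
      open ≡.≡-Reasoning

    -- The base point cancels. This makes the comparison of two lifts of one space a plain character
    -- sum.
    lift-+ : ∀ t t′ p → exponent (lift t) p ℙ.+ exponent (lift t′) p ≡ (t ⊕ t′) ∙ p
    lift-+ t t′ p = begin
      η p ℙ.+ t ∙ p ℙ.+ (η p ℙ.+ t′ ∙ p)
        ≡⟨ interchange (η p) (t ∙ p) (η p) (t′ ∙ p) ⟩
      η p ℙ.+ η p ℙ.+ (t ∙ p ℙ.+ t′ ∙ p)
        ≡⟨ ≡.cong₂ ℙ._+_ (ℙ.p+p≡0ℙ (η p)) (≡.sym (∙-distribʳ-⊕ p t t′)) ⟩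
      (t ⊕ t′) ∙ p ∎
      where
      open CommutativeSemigroupProperties ℙ.+-commutativeSemigroup using (interchange)
      open ≡.≡-Reasoning

    lift-injective : ∀ {t t′} → (∀ p → exponent (lift t) p ≡ exponent (lift t′) p) → t ≡ t′
    lift-injective {t} {t′} eq with (t ⊕ t′) ≟ᵁ 𝟎
    ... | yes t⊕t′≡𝟎 = ⊕≡𝟎⇒≡ t⊕t′≡𝟎
    ... | no t⊕t′≢𝟎 with separating-vector (t ⊕ t′) t⊕t′≢𝟎
    ...   | a , ≡1 = contradiction (≡.trans (≡.sym (≡.trans (≡.cong (ℙ._+ exponent (lift t′) a) (eq a))
                       (ℙ.p+p≡0ℙ (exponent (lift t′) a)))) (≡.trans (lift-+ t t′ a) ≡1)) λ ()

    -- Two refinements of the same form have an additive difference, which is a dot product.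
    lift-surjective : (f : U r → Parity) → IsRefinement (polar C) f →
                      ∃[ t ] (∀ p → f p ≡ exponent (lift t) p)
    lift-surjective f refines = let t , f+η≡t∙ = additive⇒∙ (λ p → f p ℙ.+ η p) additive in
      t , λ p → ≡.trans (≡.sym (p+p+q≡q (η p) (f p)))
                  (≡.cong (η p ℙ.+_) (≡.trans (ℙ.+-comm (η p) (f p)) (f+η≡t∙ p)))
      where
      open CommutativeSemigroupProperties ℙ.+-commutativeSemigroup using (interchange)
      open ≡.≡-Reasoning
      additive : Additive (λ p → f p ℙ.+ η p)
      additive p q = begin
        f (p ⊕ q) ℙ.+ η (p ⊕ q)
          ≡⟨ ≡.cong₂ ℙ._+_ (refines p q) (proj₂ refinement p q) ⟩
        f p ℙ.+ f q ℙ.+ polar C p q ℙ.+ (η p ℙ.+ η q ℙ.+ polar C p q)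
          ≡⟨ interchange (f p ℙ.+ f q) (polar C p q) (η p ℙ.+ η q) (polar C p q) ⟩
        f p ℙ.+ f q ℙ.+ (η p ℙ.+ η q) ℙ.+ (polar C p q ℙ.+ polar C p q)
          ≡⟨ ≡.cong₂ ℙ._+_ (interchange (f p) (f q) (η p) (η q)) (ℙ.p+p≡0ℙ (polar C p q)) ⟩
        f p ℙ.+ η p ℙ.+ (f q ℙ.+ η q) ℙ.+ 0ℙ
          ≡⟨ ℙ.+-identityʳ _ ⟩
        f p ℙ.+ η p ℙ.+ (f q ℙ.+ η q) ∎

  -- An inverse of `vec` found by search. A character is a function on all of E, so points outside
  -- `P` need a value; 𝟎 is an arbitrary one.
  coord : ∣Ē∣ i → U r
  coord x with anyᵁ? (λ p → vec p ≟ᴱ̄ x)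
  ... | yes (p , _) = p
  ... | no _        = 𝟎

  coord-vec : ∀ p → coord (vec p) ≡ p
  coord-vec p with anyᵁ? (λ q → vec q ≟ᴱ̄ vec p)
  ... | yes (q , eq) = injective eq
  ... | no none      = contradiction (p , ≡.refl) none

  module _ (L : Lift C) where

    character : E i → Sign
    character (s , x) = s Sign.* toSign (exponent L (coord x))

    character-vec : ∀ s p → character (s , vec p) ≡ s Sign.* toSign (exponent L p)
    character-vec s p = ≡.cong (λ q → s Sign.* toSign (exponent L q)) (coord-vec p)

    -- The sign of a product in E is also the defect of additivity of the exponent, and the two
    -- copies cancel.
    character-isCharacter : IsCharacter (Preimage P) character
    character-isCharacter (s , x) (s′ , y) x∈P y∈P
      with surjective x∈P | surjective y∈P
    ... | p , ≡.refl | q , ≡.refl = begin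
      character (s Sign.* s′ Sign.* toSign (polar C p q) , vec p +ᴱ vec q)
        ≡⟨ ≡.cong (λ z → character (s Sign.* s′ Sign.* toSign (polar C p q) , z)) (vec-⊕ p q) ⟨
      character (s Sign.* s′ Sign.* toSign (polar C p q) , vec (p ⊕ q))
        ≡⟨ character-vec (s Sign.* s′ Sign.* toSign (polar C p q)) (p ⊕ q) ⟩
      s Sign.* s′ Sign.* toSign (polar C p q) Sign.* toSign (ε (p ⊕ q))
        ≡⟨ Sign.*-assoc (s Sign.* s′) _ _ ⟩
      s Sign.* s′ Sign.* (toSign (polar C p q) Sign.* toSign (ε (p ⊕ q)))
        ≡⟨ ≡.cong (s Sign.* s′ Sign.*_) (≡.trans (≡.sym (ℙ.+-homo-* (polar C p q) (ε (p ⊕ q))))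
             (≡.trans (≡.cong toSign signs) (ℙ.+-homo-* (ε p) (ε q)))) ⟩
      s Sign.* s′ Sign.* (toSign (ε p) Sign.* toSign (ε q))
        ≡⟨ interchange s s′ (toSign (ε p)) (toSign (ε q)) ⟩
      s Sign.* toSign (ε p) Sign.* (s′ Sign.* toSign (ε q))
        ≡⟨ ≡.cong₂ Sign._*_ (character-vec s p) (character-vec s′ q) ⟨
      character (s , vec p) Sign.* character (s′ , vec q) ∎
      where
      open CommutativeSemigroupProperties Sign.*-commutativeSemigroup using (interchange)
      open ≡.≡-Reasoning
      ε = exponent L
      signs : polar C p q ℙ.+ ε (p ⊕ q) ≡ ε p ℙ.+ ε q
      signs = ≡.trans (≡.cong (polar C p q ℙ.+_) (≡.trans (refines L p q) (ℙ.+-comm _ (polar C p q))))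
                (p+p+q≡q (polar C p q) _)

    character-I : character -I ≡ Sign.-
    character-I = ≡.trans (≡.cong (λ x → character (Sign.- , x)) (≡.sym (vec-𝟎 C)))
      (≡.trans (character-vec Sign.- 𝟎) (≡.cong (λ ς → Sign.- Sign.* toSign ς) (exponent-𝟎 L)))

  module _ (χ : E i → Sign) (isCharacter : IsCharacter (Preimage P) χ) (χ-I : χ -I ≡ Sign.-) where

    character-exponent : U r → Parity
    character-exponent p = fromSign (χ (Sign.+ , vec p))

    private
      toSign-fromSign : ∀ s → toSign (fromSign s) ≡ s
      toSign-fromSign Sign.+ = ≡.refl
      toSign-fromSign Sign.- = ≡.refl

      𝟎∙ : ∀ {n} (u : U n) → 𝟎 ∙ u ≡ 0ℙ
      𝟎∙ u = ≡.trans (∙-comm 𝟎 u) (∙-zeroʳ u)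

      𝟎∈P : P (𝟎 , 𝟎)
      𝟎∈P = ≡.subst P (vec-𝟎 C) (member 𝟎)

    -- The negative preimage is -I times the positive one, so χ(-I) = -1 determines χ from its
    -- values on positive preimages.
    character-toSign : ∀ s p → χ (s , vec p) ≡ s Sign.* toSign (character-exponent p)
    character-toSign Sign.+ p = ≡.sym (toSign-fromSign _)
    character-toSign Sign.- p = begin
      χ (Sign.- , vec p)
        ≡⟨ ≡.cong χ (≡.cong₂ _,_ (≡.cong (λ ς → Sign.- Sign.* toSign ς) (𝟎∙ (proj₁ (vec p))))
             (≡.cong₂ _,_ (⊕-identityˡ _) (⊕-identityˡ _))) ⟨
      χ (-I ∘ᴱ (Sign.+ , vec p))
        ≡⟨ isCharacter -I (Sign.+ , vec p) 𝟎∈P (member p) ⟩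
      χ -I Sign.* χ (Sign.+ , vec p)
        ≡⟨ ≡.cong₂ Sign._*_ χ-I (≡.sym (toSign-fromSign _)) ⟩
      Sign.- Sign.* toSign (character-exponent p) ∎
      where open ≡.≡-Reasoning

    -- Multiplicativity is applied to two positive preimages, whose product carries the sign of
    -- `polar C p q`.
    character-refines : IsRefinement (polar C) character-exponent
    character-refines p q = ℙ.toSign-injective (begin
      toSign (f (p ⊕ q))
        ≡⟨ ≡.cong (Sign._* toSign (f (p ⊕ q))) (Sign.s*s≡+ (toSign (polar C p q))) ⟨
      toSign (polar C p q) Sign.* toSign (polar C p q) Sign.* toSign (f (p ⊕ q))
        ≡⟨ Sign.*-assoc (toSign (polar C p q)) _ _ ⟩
      toSign (polar C p q) Sign.* (toSign (polar C p q) Sign.* toSign (f (p ⊕ q)))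
        ≡⟨ ≡.cong (toSign (polar C p q) Sign.*_) (character-toSign (toSign (polar C p q)) (p ⊕ q)) ⟨
      toSign (polar C p q) Sign.* χ (toSign (polar C p q) , vec (p ⊕ q))
        ≡⟨ ≡.cong (λ x → toSign (polar C p q) Sign.* χ (toSign (polar C p q) , x)) (vec-⊕ p q) ⟩
      toSign (polar C p q) Sign.* χ ((Sign.+ , vec p) ∘ᴱ (Sign.+ , vec q))
        ≡⟨ ≡.cong (toSign (polar C p q) Sign.*_) (isCharacter _ _ (member p) (member q)) ⟩
      toSign (polar C p q) Sign.* (χ (Sign.+ , vec p) Sign.* χ (Sign.+ , vec q))
        ≡⟨ ≡.cong (toSign (polar C p q) Sign.*_) (≡.cong₂ Sign._*_ (character-toSign Sign.+ p) (character-toSign Sign.+ q)) ⟩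
      toSign (polar C p q) Sign.* (toSign (f p) Sign.* toSign (f q))
        ≡⟨ ≡.trans (Sign.*-comm (toSign (polar C p q)) _)
             (≡.cong (Sign._* toSign (polar C p q)) (≡.sym (ℙ.+-homo-* (f p) (f q)))) ⟩
      toSign (f p ℙ.+ f q) Sign.* toSign (polar C p q)
        ≡⟨ ℙ.+-homo-* (f p ℙ.+ f q) (polar C p q) ⟨
      toSign (f p ℙ.+ f q ℙ.+ polar C p q) ∎)
      where
      open ≡.≡-Reasoning
      f = character-exponent

-- Traces of products of two eigenprojections

module Agreement {c ℓ₁ ℓ₂ : Level} (R : RealField c ℓ₁ ℓ₂) (i : ℕ) where
  open RealField R hiding (zero)
  open Grassmannians R
  open Clifford R i using (⟦_⟧; _⊙_; ⊙-cong; ⊙-assoc; ⟦⟧-∘; Eigenspace)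
  open RealFieldProperties R
  open Projections R
  open Eigenplanes R i
  open RingProperties ring
  open SemiringSum semiring using (sum-cong-≋; ∑-comm; *-distribˡ-sum)
  open ≈-Reasoning setoid

  private
    σ : Parity → Sign
    σ = toSign

  -- χ enters only through its values on the preimage, so that this serves both the constructed
  -- `character` and a character that is given.
  Fixed≐Eigenspace : ∀ {r} {P : Pred (∣Ē∣ i) 0ℓ} (C : Coordinates P r) (isotropic : Isotropic C) (L : Lift C)
    (χ : E i → Sign) → (∀ s p → χ (s , Coordinates.vec C p) ≡ s Sign.* σ (exponent L p)) →
    Fixed (eigenprojection C isotropic L) ≐ Eigenspace (Preimage P) χ
  Fixed≐Eigenspace {P = P} C isotropic L χ χ≡ = to , from
    where
    open Coordinates C
    to : ∀ {v} → Fixed (eigenprojection C isotropic L) v → Eigenspace (Preimage P) χ v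
    to {v} fixed (s , x) x∈P j with surjective x∈P
    ... | p , ≡.refl = begin
      s ⊙ ⟦ Sign.+ , vec p ⟧ v j       ≈⟨ ⊙-cong s (Fixed⇒Eigenvector C isotropic L fixed p j) ⟩
      s ⊙ σ (exponent L p) ⊙ v j       ≈⟨ ⊙-assoc s (σ (exponent L p)) (v j) ⟨
      (s Sign.* σ (exponent L p)) ⊙ v j ≡⟨ ≡.cong (_⊙ v j) (χ≡ s p) ⟨
      χ (s , vec p) ⊙ v j              ∎
    from : ∀ {v} → Eigenspace (Preimage P) χ v → Fixed (eigenprojection C isotropic L) v
    from {v} eigen = Eigenvector⇒Fixed C isotropic L (λ p x → trans (eigen (Sign.+ , vec p) (member p) x)
      (reflexive (≡.cong (_⊙ v x) (χ≡ Sign.+ p))))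

  -- Different elements of Ē have a product other than ± I, of trace 0. For x = y the product is a
  -- square, and isotropy makes it + I.
  operator-trace-∘ : ∀ x y → proj₂ x ∙ proj₁ x ≡ 0ℙ →
    operator-trace ((Sign.+ , x) ∘ᴱ (Sign.+ , y)) ≈ 2# ^ i * indicator (x ≟ᴱ̄ y)
  operator-trace-∘ x y isotropic with x ≟ᴱ̄ y
  ... | yes ≡.refl = begin
    operator-trace (σ (proj₂ x ∙ proj₁ x) , x +ᴱ x)
      ≡⟨ ≡.cong₂ (λ ς z → operator-trace (σ ς , z)) isotropic (≡.cong₂ _,_ (⊕-self (proj₁ x)) (⊕-self (proj₂ x))) ⟩
    operator-trace I
      ≈⟨ operator-trace-I ⟩
    2# ^ i
      ≈⟨ *-identityʳ _ ⟨
    2# ^ i * 1# ∎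
  ... | no x≢y = begin
    operator-trace (s , x +ᴱ y)
      ≈⟨ ⊙-sum s (λ z → ⟦ Sign.+ , x +ᴱ y ⟧ (δ z) z) ⟨
    s ⊙ operator-trace (Sign.+ , x +ᴱ y)
      ≈⟨ ⊙-cong s (operator-trace-0 (λ eq → x≢y (≡.cong₂ _,_
           (⊕≡𝟎⇒≡ (≡.cong proj₁ eq)) (⊕≡𝟎⇒≡ (≡.cong proj₂ eq))))) ⟩
    s ⊙ 0#
      ≈⟨ trans (⊙-0 s) (sym (zeroʳ _)) ⟩
    2# ^ i * 0# ∎
    where s = σ (proj₂ x ∙ proj₁ y)

  -1≉1 : ¬ (- 1# ≈ 1#)
  -1≉1 -1≈1 = <-irrefl (sym (x≈-x⇒x≈0 (sym -1≈1))) 0<1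

  σσ1≈1 : ∀ p q → σ p ⊙ σ q ⊙ 1# ≈ 1# → p ≡ q
  σσ1≈1 0ℙ 0ℙ _    = ≡.refl
  σσ1≈1 0ℙ 1ℙ -1≈1 = contradiction -1≈1 -1≉1
  σσ1≈1 1ℙ 0ℙ -1≈1 = contradiction -1≈1 -1≉1
  σσ1≈1 1ℙ 1ℙ _    = ≡.refl

  module _ {r r′ : ℕ} {P P′ : Pred (∣Ē∣ i) 0ℓ}
           (C : Coordinates P r) (isotropic : Isotropic C) (L : Lift C)
           (C′ : Coordinates P′ r′) (isotropic′ : Isotropic C′) (L′ : Lift C′) where
    private
      module C = Coordinates C
      module C′ = Coordinates C′
      ε = exponent L
      ε′ = exponent L′
      Π = eigenprojection C isotropic L
      Π′ = eigenprojection C′ isotropic′ L′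

    -- At most one term is nonzero: the product of the two signs if `C.vec p` lies in P′. The sum
    -- over `q` is the form in which it comes out of the product of averages.
    agreement : U r → Carrier
    agreement p = ∑ᵁ (λ q → σ (ε p) ⊙ σ (ε′ q) ⊙ indicator (C.vec p ≟ᴱ̄ C′.vec q))

    trace-product : trace (Π ⊗ Π′) ≈ ½ ^ r * (½ ^ r′ * (2# ^ i * ∑ᵁ agreement))
    trace-product = begin
      sum (λ x → (Π $ average C′ isotropic′ L′ (δ x)) x)
        ≈⟨ sum-cong-≋ diagonal ⟩
      sum (λ x → ½ ^ r * (½ ^ r′ * ∑ᵁ (λ p → ∑ᵁ (λ q → f p q x))))
        ≈⟨ trans (sym (*-distribˡ-sum (½ ^ r) (λ x → ½ ^ r′ * ∑ᵁ (λ p → ∑ᵁ (λ q → f p q x)))))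
             (*-congˡ (sym (*-distribˡ-sum (½ ^ r′) (λ x → ∑ᵁ (λ p → ∑ᵁ (λ q → f p q x)))))) ⟩
      ½ ^ r * (½ ^ r′ * sum (λ x → ∑ᵁ (λ p → ∑ᵁ (λ q → f p q x))))
        ≈⟨ *-congˡ (*-congˡ (∑-comm (λ x j → ∑ᵁ (λ q → f (label {r} j) q x)))) ⟩
      ½ ^ r * (½ ^ r′ * ∑ᵁ (λ p → sum (λ x → ∑ᵁ (λ q → f p q x))))
        ≈⟨ *-congˡ (*-congˡ (∑ᵁ-cong (λ p → ∑-comm (λ x j → f p (label {r′} j) x)))) ⟩
      ½ ^ r * (½ ^ r′ * ∑ᵁ (λ p → ∑ᵁ (λ q → sum (f p q))))
        ≈⟨ *-congˡ (*-congˡ (∑ᵁ-cong (λ p → trans (∑ᵁ-cong (summand p)) (sym (*-distribˡ-∑ᵁ (2# ^ i)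
             (λ q → σ (ε p) ⊙ σ (ε′ q) ⊙ indicator (C.vec p ≟ᴱ̄ C′.vec q))))))) ⟩
      ½ ^ r * (½ ^ r′ * ∑ᵁ (λ p → 2# ^ i * agreement p))
        ≈⟨ *-congˡ (*-congˡ (*-distribˡ-∑ᵁ (2# ^ i) agreement)) ⟨
      ½ ^ r * (½ ^ r′ * (2# ^ i * ∑ᵁ agreement)) ∎
      where
      f : U r → U r′ → Fin (2 ^ℕ i) → Carrier
      f p q x = σ (ε p) ⊙ σ (ε′ q) ⊙ ⟦ Sign.+ , C.vec p ⟧ (⟦ Sign.+ , C′.vec q ⟧ (δ x)) x

      diagonal : ∀ x → (Π $ average C′ isotropic′ L′ (δ x)) x ≈
                       ½ ^ r * (½ ^ r′ * ∑ᵁ (λ p → ∑ᵁ (λ q → f p q x)))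
      diagonal x = trans (eigenprojection-$ C isotropic L (average C′ isotropic′ L′ (δ x)) x) (*-congˡ (trans
        (∑ᵁ-cong (λ p → trans
          (⊙-cong (σ (ε p)) (⟦⟧-average C′ isotropic′ L′ (Sign.+ , C.vec p) (δ x) x))
          (trans (sym (*-⊙ (σ (ε p)) (½ ^ r′) _))
            (*-congˡ (⊙-∑ᵁ (σ (ε p)) (λ q → σ (ε′ q) ⊙ ⟦ Sign.+ , C.vec p ⟧ (⟦ Sign.+ , C′.vec q ⟧ (δ x)) x))))))
        (sym (*-distribˡ-∑ᵁ (½ ^ r′) (λ p → ∑ᵁ (λ q → f p q x))))))

      summand : ∀ p q → sum (f p q) ≈
        2# ^ i * (σ (ε p) ⊙ σ (ε′ q) ⊙ indicator (C.vec p ≟ᴱ̄ C′.vec q))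
      summand p q = begin
        sum (f p q)
          ≈⟨ ⊙-sum (σ (ε p)) (λ x → σ (ε′ q) ⊙ ⟦ Sign.+ , C.vec p ⟧ (⟦ Sign.+ , C′.vec q ⟧ (δ x)) x) ⟨
        σ (ε p) ⊙ sum (λ x → σ (ε′ q) ⊙ ⟦ Sign.+ , C.vec p ⟧ (⟦ Sign.+ , C′.vec q ⟧ (δ x)) x)
          ≈⟨ ⊙-cong (σ (ε p)) (⊙-sum (σ (ε′ q)) (λ x → ⟦ Sign.+ , C.vec p ⟧ (⟦ Sign.+ , C′.vec q ⟧ (δ x)) x)) ⟨
        σ (ε p) ⊙ σ (ε′ q) ⊙ sum (λ x → ⟦ Sign.+ , C.vec p ⟧ (⟦ Sign.+ , C′.vec q ⟧ (δ x)) x)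
          ≈⟨ ⊙-cong (σ (ε p)) (⊙-cong (σ (ε′ q)) (trans
               (sum-cong-≋ (λ x → sym (⟦⟧-∘ (Sign.+ , C.vec p) (Sign.+ , C′.vec q) (δ x) x)))
               (operator-trace-∘ (C.vec p) (C′.vec q) (isotropic p)))) ⟩
        σ (ε p) ⊙ σ (ε′ q) ⊙ (2# ^ i * indicator (C.vec p ≟ᴱ̄ C′.vec q))
          ≈⟨ trans (*-⊙ (σ (ε p)) (2# ^ i) _) (⊙-cong (σ (ε p)) (*-⊙ (σ (ε′ q)) (2# ^ i) _)) ⟨
        2# ^ i * (σ (ε p) ⊙ σ (ε′ q) ⊙ indicator (C.vec p ≟ᴱ̄ C′.vec q)) ∎

    agreement-0 : ∀ p q → C.vec p ≢ C′.vec q → σ (ε p) ⊙ σ (ε′ q) ⊙ indicator (C.vec p ≟ᴱ̄ C′.vec q) ≈ 0#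
    agreement-0 p q ≢q = trans
      (⊙-cong (σ (ε p)) (trans (⊙-cong (σ (ε′ q)) (indicator-no (C.vec p ≟ᴱ̄ C′.vec q) ≢q)) (⊙-0 (σ (ε′ q)))))
      (⊙-0 (σ (ε p)))

    agreement-hit : ∀ p q → C.vec p ≡ C′.vec q → agreement p ≈ σ (ε p) ⊙ σ (ε′ q) ⊙ 1#
    agreement-hit p q ≡q = trans
      (∑ᵁ-single q _ (λ q′ q′≢q → agreement-0 p q′ (λ ≡q′ → q′≢q (C′.injective (≡.trans (≡.sym ≡q′) ≡q)))))
      (⊙-cong (σ (ε p)) (⊙-cong (σ (ε′ q)) (indicator-yes (C.vec p ≟ᴱ̄ C′.vec q) ≡q)))

    agreement-miss : ∀ p → ¬ (∃[ q ] C.vec p ≡ C′.vec q) → agreement p ≈ 0#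
    agreement-miss p none = ∑ᵁ-zero (λ q → agreement-0 p q (λ eq → none (q , eq)))

    hit? : ∀ p → Dec (∃[ q ] C.vec p ≡ C′.vec q)
    hit? p = anyᵁ? (λ q → C.vec p ≟ᴱ̄ C′.vec q)

    agreement-hit-≤1 : ∀ p q → C.vec p ≡ C′.vec q → agreement p ≤ 1#
    agreement-hit-≤1 p q eq = ≤-trans
      (≈⇒≤ (trans (agreement-hit p q eq) (sym (⊙-assoc (σ (ε p)) (σ (ε′ q)) 1#))))
      (⊙1≤1 (σ (ε p) Sign.* σ (ε′ q)))

    agreement≤1 : ∀ p → agreement p ≤ 1#
    agreement≤1 p with hit? p
    ... | yes (q , eq) = agreement-hit-≤1 p q eq
    ... | no none      = ≤-trans (≈⇒≤ (agreement-miss p none)) (<-asym 0<1)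

    ∑agreement≤2^r : ∑ᵁ agreement ≤ 2# ^ r
    ∑agreement≤2^r = ≤-trans (∑ᵁ-mono-≤ agreement≤1) (≈⇒≤ (∑ᵁ-1 r))

    -- Double counting of the pairs (p , u) with D.vec u = C.vec p: each `u` has exactly one `p`,
    -- and each `p` in the intersection has one `u`.
    ∑agreement≤∣P∩P′∣ : ∀ {r″} → Coordinates (P ∩ P′) r″ → ∑ᵁ agreement ≤ 2# ^ r″
    ∑agreement≤∣P∩P′∣ {r″} D = ≤-trans (∑ᵁ-mono-≤ agreement≤) (≈⇒≤ (begin
      ∑ᵁ (λ p → ∑ᵁ (λ u → indicator (D.vec u ≟ᴱ̄ C.vec p)))
        ≈⟨ ∑-comm (λ j j′ → indicator (D.vec (label {r″} j′) ≟ᴱ̄ C.vec (label {r} j))) ⟩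
      ∑ᵁ (λ u → ∑ᵁ (λ p → indicator (D.vec u ≟ᴱ̄ C.vec p)))
        ≈⟨ ∑ᵁ-cong (λ u → count u (C.surjective (proj₁ (D.member u)))) ⟩
      ∑ᵁ {r″} (λ _ → 1#)
        ≈⟨ ∑ᵁ-1 r″ ⟩
      2# ^ r″ ∎))
      where
      module D = Coordinates D
      count : ∀ u → ∃[ p ] C.vec p ≡ D.vec u → ∑ᵁ (λ p → indicator (D.vec u ≟ᴱ̄ C.vec p)) ≈ 1#
      count u (p , eq) = trans
        (∑ᵁ-single p _ (λ p′ p′≢p → indicator-no (D.vec u ≟ᴱ̄ C.vec p′)
          (λ eq′ → p′≢p (C.injective (≡.trans (≡.sym eq′) (≡.sym eq))))))
        (indicator-yes (D.vec u ≟ᴱ̄ C.vec p) (≡.sym eq))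

      agreement≤ : ∀ p → agreement p ≤ ∑ᵁ (λ u → indicator (D.vec u ≟ᴱ̄ C.vec p))
      agreement≤ p with hit? p
      ... | no none = ≤-trans (≈⇒≤ (trans (agreement-miss p none) (sym (∑ᵁ-zero {r″} (λ _ → refl)))))
                        (∑ᵁ-mono-≤ (λ u → indicator-nonneg (D.vec u ≟ᴱ̄ C.vec p)))
      ... | yes (q , eq) with D.surjective (C.member p , ≡.subst P′ (≡.sym eq) (C′.member q))
      ...   | u , eq′ = ≤-trans (agreement-hit-≤1 p q eq) (≈⇒≤ (sym (trans
        (∑ᵁ-single u _ (λ u′ u′≢u → indicator-no (D.vec u′ ≟ᴱ̄ C.vec p)
          (λ eq″ → u′≢u (D.injective (≡.trans eq″ (≡.sym eq′))))))
        (indicator-yes (D.vec u ≟ᴱ̄ C.vec p) eq′))))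

    -- There are 2^r terms of size at most 1, so each must be 1; a miss would give 0 and opposite
    -- signs -1.
    ∑agreement-extremal : ∑ᵁ agreement ≈ 2# ^ r → ∀ p → ∃[ q ] (C.vec p ≡ C′.vec q × ε p ≡ ε′ q)
    ∑agreement-extremal extremal p with hit? p
    ... | yes (q , eq) = q , eq , σσ1≈1 (ε p) (ε′ q)
                           (trans (sym (agreement-hit p q eq)) (∑ᵁ-extremal agreement agreement≤1 extremal p))
    ... | no none = contradiction 0<1 (<-irrefl (trans (sym (agreement-miss p none))
                      (∑ᵁ-extremal agreement agreement≤1 extremal p)))

    -- The columns of Π′ are fixed by Π, so Π Π′ = Π′. The two formulas for its trace are then
    -- compared.
    same-plane⇒∑agreement≈2^r : Fixed Π ≐ Fixed Π′ → ∑ᵁ agreement ≈ 2# ^ r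
    same-plane⇒∑agreement≈2^r (_ , Π′⊆Π) = *-cancelˡ (½^*2^ i) (begin
      2# ^ i * ∑ᵁ agreement
        ≈⟨ *-cancelˡ (2^*½^ r′) (trans (sym traces) (*-cancel-r)) ⟩
      2# ^ r * 2# ^ i
        ≈⟨ *-comm _ _ ⟩
      2# ^ i * 2# ^ r ∎)
      where
      column-fixed : ∀ x → Fixed Π (λ z → Π′ z x)
      column-fixed x = Π′⊆Π (λ z → eigenprojection-idempotent C′ isotropic′ L′ z x)
      product : trace (Π ⊗ Π′) ≈ ½ ^ r′ * 2# ^ i
      product = trans (sum-cong-≋ (λ x → column-fixed x x)) (trace-eigenprojection C′ isotropic′ L′)
      traces : ½ ^ r′ * 2# ^ i * 2# ^ r ≈ ½ ^ r′ * (2# ^ i * ∑ᵁ agreement)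
      traces = begin
        ½ ^ r′ * 2# ^ i * 2# ^ r
          ≈⟨ *-comm _ _ ⟩
        2# ^ r * (½ ^ r′ * 2# ^ i)
          ≈⟨ *-congˡ (trans (sym product) trace-product) ⟩
        2# ^ r * (½ ^ r * (½ ^ r′ * (2# ^ i * ∑ᵁ agreement)))
          ≈⟨ *-cancel-inverse (2^*½^ r) _ ⟩
        ½ ^ r′ * (2# ^ i * ∑ᵁ agreement) ∎
      *-cancel-r : ½ ^ r′ * 2# ^ i * 2# ^ r ≈ ½ ^ r′ * (2# ^ r * 2# ^ i)
      *-cancel-r = trans (*-assoc _ _ _) (*-congˡ (*-comm _ _))

  -- Within one space every `p` is matched with itself, which leaves the character sum of `t ⊕ t′`.
  distinct-lifts⇒∑agreement≈0 : ∀ {r} {P : Pred (∣Ē∣ i) 0ℓ} (C : Coordinates P r) (isotropic : Isotropic C)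
    {t t′ : U r} → t ≢ t′ →
    ∑ᵁ (agreement C isotropic (lift C isotropic t) C isotropic (lift C isotropic t′)) ≈ 0#
  distinct-lifts⇒∑agreement≈0 C isotropic {t} {t′} t≢t′ = trans
    (∑ᵁ-cong (λ p → trans
      (agreement-hit C isotropic (lift C isotropic t) C isotropic (lift C isotropic t′) p p ≡.refl)
      (trans (sym (σ-+ (exponent (lift C isotropic t) p) (exponent (lift C isotropic t′) p) 1#)) (reflexive (≡.cong (λ ς → σ ς ⊙ 1#) (lift-+ C isotropic t t′ p))))))
    (character-sum (t≢t′ ∘ ⊕≡𝟎⇒≡))

-- The packing and its distances

module CliffordPacking {c ℓ₁ ℓ₂ : Level} (R : RealField c ℓ₁ ℓ₂) (i k ℓ M : ℕ) (k≤i : k ≤ℕ i)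
  (S̄ : Fin M → Pred (∣Ē∣ i) 0ℓ)
  (isSubspaceˢ : ∀ j → IsĒSubspace (S̄ j))
  (singular : ∀ j → TotallySingular (S̄ j))
  (dimensionˢ : ∀ j → HasĒDimension (S̄ j) (i ∸ k))
  (distinctˢ : ∀ j j′ → j ≢ j′ → ¬ (S̄ j ≐ S̄ j′))
  (meets : ∀ j j′ → j ≢ j′ → ∃[ r ] (r ≤ℕ ℓ × HasĒDimension (S̄ j ∩ S̄ j′) r))
  where
  open RealField R hiding (zero)
  open Grassmannians R
  open Clifford R i using (IsInvariantSubspace)
  open RealFieldProperties R
  open Projections R
  open Eigenplanes R i
  open Agreement R i
  open ≈-Reasoning setoid

  r : ℕ
  r = i ∸ k

  N : ℕ
  N = 2 ^ℕ r *ℕ M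

  r+k≡i : r +ℕ k ≡ i
  r+k≡i = ℕ.m∸n+n≡m k≤i

  C : ∀ j → Coordinates (S̄ j) r
  C j = coordinates (isSubspaceˢ j) (dimensionˢ j)

  isotropic : ∀ j → Isotropic (C j)
  isotropic j = singular⇒isotropic (C j) (singular j)

  L : ∀ j → U r → Lift (C j)
  L j = lift (C j) (isotropic j)

  2^i : 2# ^ i ≈ 2# ^ r * 2# ^ k
  2^i = trans (reflexive (≡.cong (2# ^_) (≡.sym r+k≡i))) (^-homo-+ 2# r k)

  Π : Fin M → U r → Matrix (2 ^ℕ i)
  Π j t = eigenprojection (C j) (isotropic j) (L j t)

  trace-Π : ∀ j t → trace (Π j t) ≈ (2 ^ℕ k) · 1#
  trace-Π j t = begin
    trace (Π j t)                 ≈⟨ trace-eigenprojection (C j) (isotropic j) (L j t) ⟩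
    ½ ^ r * 2# ^ i                ≈⟨ *-congˡ 2^i ⟩
    ½ ^ r * (2# ^ r * 2# ^ k)     ≈⟨ *-cancel-inverse (½^*2^ r) (2# ^ k) ⟩
    2# ^ k                        ≈⟨ 2^ℕ·1 k ⟨
    (2 ^ℕ k) · 1#                 ∎

  eigenplane : Fin M → U r → Grassmannian (2 ^ℕ i) (2 ^ℕ k)
  eigenplane j t = fixed-plane (eigenprojection-isMonomial (C j) (isotropic j) (L j t)) (trace-Π j t)

  ∑agreement : Fin M → U r → Fin M → U r → Carrier
  ∑agreement j t j′ t′ = ∑ᵁ (agreement (C j) (isotropic j) (L j t) (C j′) (isotropic j′) (L j′ t′))

  Differ : Fin M → U r → Fin M → U r → Set
  Differ j t j′ t′ = ¬ (j ≡ j′ × t ≡ t′)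

  ∑agreement≤2^ℓ : ∀ j t j′ t′ → Differ j t j′ t′ → ∑agreement j t j′ t′ ≤ 2# ^ ℓ
  ∑agreement≤2^ℓ j t j′ t′ differ = by-cases (j ≟ j′)
    where
    by-cases : Dec (j ≡ j′) → ∑agreement j t j′ t′ ≤ 2# ^ ℓ
    by-cases (yes ≡.refl) = ≤-trans
      (≈⇒≤ (distinct-lifts⇒∑agreement≈0 (C j) (isotropic j) (differ ∘ (≡.refl ,_))))
      (<-asym (0<2^ ℓ))
    by-cases (no j≢j′) = let r″ , r″≤ℓ , dim = meets j j′ j≢j′ in ≤-trans
      (∑agreement≤∣P∩P′∣ (C j) (isotropic j) (L j t) (C j′) (isotropic j′) (L j′ t′)
        (coordinates (∩-isSubspace (isSubspaceˢ j) (isSubspaceˢ j′)) dim))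
      (2^-mono-≤ r″≤ℓ)

  -- Applied with m = ℓ for the distance bound, and with m = r for the sign of the radicand.
  trace-product-≤ : ∀ j t j′ t′ m → ∑agreement j t j′ t′ ≤ 2# ^ m →
    trace (Π j t ⊗ Π j′ t′) ≤ ½ ^ r * (2# ^ k * 2# ^ m)
  trace-product-≤ j t j′ t′ m ∑≤ = ≤-trans
    (≈⇒≤ (trace-product (C j) (isotropic j) (L j t) (C j′) (isotropic j′) (L j′ t′)))
    (≤-trans (½^-mono-≤ r (½^-mono-≤ r (*-monoˡ-≤ (0<½^ i) (½^*2^ i) ∑≤)))
      (≈⇒≤ (*-congˡ (begin
        ½ ^ r * (2# ^ i * 2# ^ m)              ≈⟨ *-congˡ (trans (*-congʳ 2^i) (*-assoc _ _ _)) ⟩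
        ½ ^ r * (2# ^ r * (2# ^ k * 2# ^ m))   ≈⟨ *-cancel-inverse (½^*2^ r) _ ⟩
        2# ^ k * 2# ^ m                        ∎))))

  -- With i = r + k the exponent 2k + ℓ - i is k + ℓ - r.
  bound-exponent : ½ ^ r * (2# ^ k * 2# ^ ℓ) ≈ 2^ (+ (2 *ℕ k +ℕ ℓ) -ℤ + i)
  bound-exponent = sym (begin
    2^ (+ (2 *ℕ k +ℕ ℓ) -ℤ + i)
      ≈⟨ 2^[m-n] (2 *ℕ k +ℕ ℓ) i ⟩
    ½ ^ i * 2# ^ (2 *ℕ k +ℕ ℓ)
      ≡⟨ ≡.cong₂ (λ m n → ½ ^ m * 2# ^ n) (≡.sym r+k≡i)
           (≡.trans (≡.cong (λ n → k +ℕ n +ℕ ℓ) (ℕ.+-identityʳ k)) (ℕ.+-assoc k k ℓ)) ⟩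
    ½ ^ (r +ℕ k) * 2# ^ (k +ℕ (k +ℕ ℓ))
      ≈⟨ *-cong (^-homo-+ ½ r k) (trans (^-homo-+ 2# k (k +ℕ ℓ)) (*-congˡ (^-homo-+ 2# k ℓ))) ⟩
    ½ ^ r * ½ ^ k * (2# ^ k * (2# ^ k * 2# ^ ℓ))
      ≈⟨ *-assoc _ _ _ ⟩
    ½ ^ r * (½ ^ k * (2# ^ k * (2# ^ k * 2# ^ ℓ)))
      ≈⟨ *-congˡ (*-cancel-inverse (½^*2^ k) _) ⟩
    ½ ^ r * (2# ^ k * 2# ^ ℓ) ∎)

  bound : Carrier
  bound = 2^ (+ k) - 2^ (+ (2 *ℕ k +ℕ ℓ) -ℤ + i)

  bound≤distance² : ∀ j t j′ t′ → Differ j t j′ t′ →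
    bound ≤ distance (eigenplane j t) (eigenplane j′ t′) * distance (eigenplane j t) (eigenplane j′ t′)
  bound≤distance² j t j′ t′ differ = ≤-trans
    (+-mono-≤ (≈⇒≤ (sym (2^ℕ·1 k)))
      (-‿mono-≤ (≤-trans (trace-product-≤ j t j′ t′ ℓ (∑agreement≤2^ℓ j t j′ t′ differ)) (≈⇒≤ bound-exponent))))
    -- Squaring the root requires 2^k - trace ≥ 0, which follows from the crude bound 2^r on the sum
    -- of agreements.
    (≈⇒≤ (sym (√-square (0≤y-x (≤-trans
      (trace-product-≤ j t j′ t′ r (∑agreement≤2^r (C j) (isotropic j) (L j t) (C j′) (isotropic j′) (L j′ t′)))
      (≈⇒≤ (begin
        ½ ^ r * (2# ^ k * 2# ^ r)   ≈⟨ *-congˡ (*-comm _ _) ⟩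
        ½ ^ r * (2# ^ r * 2# ^ k)   ≈⟨ *-cancel-inverse (½^*2^ r) _ ⟩
        2# ^ k                      ≈⟨ 2^ℕ·1 k ⟨
        (2 ^ℕ k) · 1#               ∎)))))))

  same-plane⇒agree : ∀ {j t j′ t′} → Fixed (Π j t) ≐ Fixed (Π j′ t′) → ∀ p →
    ∃[ q ] (Coordinates.vec (C j) p ≡ Coordinates.vec (C j′) q × exponent (L j t) p ≡ exponent (L j′ t′) q)
  same-plane⇒agree {j} {t} {j′} {t′} same =
    ∑agreement-extremal (C j) (isotropic j) (L j t) (C j′) (isotropic j′) (L j′ t′)
      (same-plane⇒∑agreement≈2^r (C j) (isotropic j) (L j t) (C j′) (isotropic j′) (L j′ t′) same)

  same-plane⇒⊆ : ∀ {j t j′ t′} → Fixed (Π j t) ≐ Fixed (Π j′ t′) → ∀ {x} → S̄ j x → S̄ j′ x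
  same-plane⇒⊆ {j} {t} {j′} {t′} same x∈S =
    let p , vec-p≡x = Coordinates.surjective (C j) x∈S
        q , vec-p≡vec-q , _ = same-plane⇒agree {j} {t} {j′} {t′} same p
    in ≡.subst (S̄ j′) (≡.trans (≡.sym vec-p≡vec-q) vec-p≡x) (Coordinates.member (C j′) q)

  -- For different spaces, agreement in both directions would give both inclusions. Within one space
  -- `q` must be `p`, so the lifts coincide.
  eigenplane-injective : ∀ {j t j′ t′} → Differ j t j′ t′ → ¬ (Fixed (Π j t) ≐ Fixed (Π j′ t′))
  eigenplane-injective {j} {t} {j′} {t′} differ same = by-cases (j ≟ j′)
    where
    agree : ∀ p → ∃[ q ] (Coordinates.vec (C j) p ≡ Coordinates.vec (C j′) q ×
                          exponent (L j t) p ≡ exponent (L j′ t′) q)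
    agree = same-plane⇒agree {j} {t} {j′} {t′} same
    by-cases : ¬ Dec (j ≡ j′)
    by-cases (no j≢j′)    = distinctˢ j j′ j≢j′
      (same-plane⇒⊆ {j} {t} {j′} {t′} same , same-plane⇒⊆ {j′} {t′} {j} {t} (≐-sym same))
    by-cases (yes ≡.refl) = differ (≡.refl , lift-injective (C j) (isotropic j) (λ p →
      let q , vec-p≡vec-q , eq = agree p
      in ≡.trans eq (≡.cong (exponent (L j t′)) (≡.sym (Coordinates.injective (C j) vec-p≡vec-q)))))

  spaceIndex : Fin N → Fin M
  spaceIndex = remainder {2 ^ℕ r} M

  characterIndex : Fin N → U r
  characterIndex a = label (quotient {2 ^ℕ r} M a)

  differ : ∀ {a b} → a ≢ b → Differ (spaceIndex a) (characterIndex a) (spaceIndex b) (characterIndex b)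
  differ {a} {b} a≢b (≡j , ≡t) = a≢b (≡.trans (≡.sym (combine-remQuot {2 ^ℕ r} M a))
    (≡.trans (≡.cong₂ combine (label-injective {r} ≡t) ≡j) (combine-remQuot {2 ^ℕ r} M b)))

  packing : Packing N (2 ^ℕ i) (2 ^ℕ k)
  packing = record
    { plane    = λ a → eigenplane (spaceIndex a) (characterIndex a)
    ; distinct = eigenplane-injective ∘ differ
    }

  plane-isInvariant : ∀ j t → IsInvariantSubspace (Preimage (S̄ j)) (Fixed (Π j t))
  plane-isInvariant j t = record
    { χ           = character (C j) (L j t)
    ; isCharacter = character-isCharacter (C j) (L j t)
    ; χ-I         = character-I (C j) (L j t)
    ; eigenspace  = Fixed≐Eigenspace (C j) (isotropic j) (L j t) (character (C j) (L j t)) (character-vec (C j) (L j t))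
    }

  invariant⇒plane : ∀ j P → IsInvariantSubspace (Preimage (S̄ j)) P → ∃[ t ] (Fixed (Π j t) ≐ P)
  invariant⇒plane j P invariant =
    let t , exponent≡ = lift-surjective (C j) (isotropic j) (character-exponent (C j) χ isCharacter χ-I)
                          (character-refines (C j) χ isCharacter χ-I)
    in t , ≐-trans
      (Fixed≐Eigenspace (C j) (isotropic j) (L j t) χ (λ s p → ≡.trans
        (character-toSign (C j) χ isCharacter χ-I s p) (≡.cong (λ ς → s Sign.* toSign ς) (exponent≡ p))))
      (≐-sym eigenspace)
    where open IsInvariantSubspace invariant

  plane-surjective : ∀ j P → IsInvariantSubspace (Preimage (S̄ j)) P → ∃[ a ] (subspace (plane packing a) ≐ P)
  plane-surjective j P invariant =
    let t , Fixed≐P = invariant⇒plane j P invariant in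
    combine (index t) j ,
    -- Decoding the index returns `j` and `t` only up to propositional equality.
    ≡.subst₂ (λ j′ t′ → Fixed (Π j′ t′) ≐ P)
      (≡.sym (≡.cong proj₂ (remQuot-combine (index t) j)))
      (≡.sym (≡.trans (≡.cong (label ∘ proj₁) (remQuot-combine (index t) j)) (label-index t)))
      Fixed≐P

theorem2 :
    ∀ {c ℓ₁ ℓ₂ : Level} (R : RealField c ℓ₁ ℓ₂) (i k ℓ M : ℕ) →
    1 ≤ℕ i → k ≤ℕ i →
    let open RealField R
        open Grassmannians R
        open Clifford R i
        bound = 2^ (+ k) - 2^ (+ (2 *ℕ k +ℕ ℓ) -ℤ + i)
    in
    (S̄ : Fin M → Pred (∣Ē∣ i) 0ℓ) →
    (∀ j → IsĒSubspace (S̄ j)) →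
    (∀ j → TotallySingular (S̄ j)) →
    (∀ j → HasĒDimension (S̄ j) (i ∸ k)) →
    (∀ j j′ → j ≢ j′ → ¬ (S̄ j ≐ S̄ j′)) →
    (∀ j j′ → j ≢ j′ → ∃[ r ] (r ≤ℕ ℓ × HasĒDimension (S̄ j ∩ S̄ j′) r)) →
    Σ (Packing (2 ^ℕ (i ∸ k) *ℕ M) (2 ^ℕ i) (2 ^ℕ k)) λ 𝒫 →
      (∀ a → ∃[ j ] IsInvariantSubspace (Preimage (S̄ j)) (subspace (plane 𝒫 a))) ×
      (∀ j P → IsInvariantSubspace (Preimage (S̄ j)) P → ∃[ a ] (subspace (plane 𝒫 a) ≐ P)) ×
      (∀ a b → a ≢ b →
        bound ≤ distance (plane 𝒫 a) (plane 𝒫 b) * distance (plane 𝒫 a) (plane 𝒫 b)) ×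
      (∀ d → IsMinimalDistance 𝒫 d → bound ≤ d * d)
theorem2 R i k ℓ M _ k≤i S̄ isSubspaceˢ singular dimensionˢ distinctˢ meets =
  packing ,
  (λ a → spaceIndex a , plane-isInvariant (spaceIndex a) (characterIndex a)) ,
  plane-surjective ,
  bound≤ ,
  minimal
  where
  open RealField R
  open Grassmannians R
  open RealFieldProperties R
  open CliffordPacking R i k ℓ M k≤i S̄ isSubspaceˢ singular dimensionˢ distinctˢ meets

  bound≤ : ∀ a b → a ≢ b →
    bound ≤ distance (plane packing a) (plane packing b) * distance (plane packing a) (plane packing b)
  bound≤ a b a≢b = bound≤distance² (spaceIndex a) (characterIndex a) (spaceIndex b) (characterIndex b) (differ a≢b)

  minimal : ∀ d → IsMinimalDistance packing d → bound ≤ d * d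
  minimal d isMinimal with IsMinimalDistance.attained isMinimal
  ... | a , b , a≢b , d≈ = ≤-trans (bound≤ a b a≢b) (≈⇒≤ (sym (*-cong d≈ d≈)))
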